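{- For every Korselt number ($KN$) $n$, $$q\le Q_2\left(N_2^{ -1}(n)\right)=q_2\left(n_2^{ -1}(n)\right),$$ with equality if and only if $q=Q_2(P)=(P-1)\left(2P+\frac12-\sqrt{P-\frac34}\right)+1$. Explicitly, $$q\le\left\lfloor \sqrt[5]{2n^2}-\sqrt[10]{\frac{n^3}{64}}-\frac1{10}\sqrt[5]{\frac n4}+\frac{17}{20}\sqrt[10]{\frac n4}\right\rfloor .$$
   Context: A Korselt number ($KN$) is an integer $n$ together with a factorisation $n=\prod_{i=1}^d p_i$, where $d\ge 3$ and $1<p_1<p_2<\dots<p_d$ are odd integers (not necessarily prime), such that $p_i-1$ divides $n-1$ for every $i$, and such that $E:=\dfrac{n/p_d-1}{p_d-1}$ (which is an integer by the divisibility condition) satisfies $E\ge 2$. Notation: $P:=\prod_{i=1}^{d-2}p_i$, $q:=p_{d-1}$, $r:=p_d$, so that $n=Pqr$. The functions of a real variable used are: $Q_2(x):=(x-1)\left(2x+\frac12-\sqrt{x-\frac34}\right)+1$ and $N_2(x):=4x^5-7x^4+7x^3-4x^2+x$ for $x\ge 1$; and, for $s\ge 0$, $p_2(s):=s^2+s+1$, $q_2(s):=2s^4+3s^3+3s^2+2s+1$, $r_2(s):=2s^4+5s^3+6s^2+3s+1$, $n_2(s):=p_2(s)\,q_2(s)\,r_2(s)$. Both $N_2$ on $[1,\infty)$ and $n_2$ on $[0,\infty)$ are strictly increasing bijections onto $[1,\infty)$, and $N_2^{ -1}$, $n_2^{ -1}$ denote their inverses. -}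

module Defs where

open import Algebra.Bundles using (RawRing)
open import Data.Fin.Base as Fin using (Fin; inject₁)
open import Data.Integer.Base as ℤ using (ℤ; +_)
import Data.Integer.Properties as ℤ
open import Data.List.Base using (tabulate)
open import Data.Nat.Base as ℕ using (ℕ; zero; suc)
open import Data.Nat.Divisibility using (_∣_)
open import Data.Nat.ListAction using (product)
import Data.Nat.Properties as ℕ
open import Data.Product.Base using (∃; _×_; _,_; proj₁; proj₂)
open import Data.Rational.Base as ℚ using (ℚ; 0ℚ; 1ℚ; ½; ∣_∣)
import Data.Rational.Properties as ℚ
import Data.Rational.Unnormalised.Base as ℚᵘ
import Data.Rational.Unnormalised.Properties as ℚᵘ
open import Data.Rational.Solver using (module +-*-Solver)
open import Data.Sum.Base as Sum using (_⊎_; inj₁; inj₂)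
open import Level using (0ℓ)
open import Relation.Binary.PropositionalEquality
  using (_≡_; refl; sym; trans; cong; cong₂; subst; subst₂)
open import Relation.Nullary using (¬_; yes; no)
open import Relation.Nullary.Decidable using (toWitness)
open import Relation.Nullary.Negation using (contradiction)

-- The number of factors is d = 3 + k; the factor written p_i on paper
-- (1 ≤ i ≤ d) is p at the element i - 1 of Fin d.
record KorseltFactorisation (n : ℕ) : Set where
  field
    k : ℕ

  d : ℕ
  d = 3 ℕ.+ k

  field
    p       : Fin d → ℕ
    n≡∏p    : n ≡ product (tabulate p)
    1<p     : ∀ i → 1 ℕ.< p i
    p-mono  : ∀ i j → i Fin.< j → p i ℕ.< p j
    p-odd   : ∀ i → ¬ (2 ∣ p i)
    p-1∣n-1 : ∀ i → (p i ℕ.∸ 1) ∣ (n ℕ.∸ 1)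

  P q r : ℕ
  P = product (tabulate (λ (i : Fin (suc k)) → p (inject₁ (inject₁ i))))
  q = p (inject₁ (Fin.fromℕ (suc k)))
  r = p (Fin.fromℕ (2 ℕ.+ k))

  -- Both divisions are exact: r divides n, and r ∸ 1 divides n / r ∸ 1
  -- because it divides n ∸ 1.
  E : ℕ
  E = ((n ℕ./ r) ℕ.∸ 1) ℕ./ (r ℕ.∸ 1)
    where instance
      r≢0 : ℕ.NonZero r
      r≢0 = ℕ.>-nonZero (ℕ.<-trans ℕ.z<s (1<p _))
      r-1≢0 : ℕ.NonZero (r ℕ.∸ 1)
      r-1≢0 = ℕ.>-nonZero (ℕ.m<n⇒0<n∸m (1<p _))

record KorseltNumber (n : ℕ) : Set where
  field
    factorisation : KorseltFactorisation n
  open KorseltFactorisation factorisation public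
  field
    E≥2 : 2 ℕ.≤ E

-- m · x is the m-fold sum x + ⋯ + x.
module Polynomials (R : RawRing 0ℓ 0ℓ) where
  open RawRing R
  open import Algebra.Definitions.RawSemiring rawSemiring public
    using (_^_) renaming (_×_ to infixr 8 _·_)

  private
    infixl 6 _-_
    _-_ : Carrier → Carrier → Carrier
    x - y = x + - y

  N₂ p₂ q₂ r₂ n₂ : Carrier → Carrier
  N₂ x = 4 · x ^ 5 - 7 · x ^ 4 + 7 · x ^ 3 - 4 · x ^ 2 + x
  p₂ s = s ^ 2 + s + 1#
  q₂ s = 2 · s ^ 4 + 3 · s ^ 3 + 3 · s ^ 2 + 2 · s + 1#
  r₂ s = 2 · s ^ 4 + 5 · s ^ 3 + 6 · s ^ 2 + 3 · s + 1#
  n₂ s = p₂ s * q₂ s * r₂ s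

module Polyℚ = Polynomials ℚ.+-*-rawRing

module RationalLemmas where
  open import Data.Rational.Base using (_+_; _-_; _*_; -_; _<_; _≤_; _/_; 1/_)
  open +-*-Solver using (solve; _:=_; _:+_; _:*_; _:-_; :-_; con)

  half-pos : ∀ {ε} → 0ℚ < ε → 0ℚ < ½ * ε
  half-pos 0<ε = ℚ.*-monoʳ-<-pos ½ 0<ε

  half+half : ∀ ε → ½ * ε + ½ * ε ≡ ε
  half+half = solve 1 (λ e → con ½ :* e :+ con ½ :* e := e) refl

  half+half-< : ∀ {a b ε} → a < ½ * ε → b < ½ * ε → a + b < ε
  half+half-< {ε = ε} a< b< = subst (_ <_) (half+half ε) (ℚ.+-mono-< a< b<)

  x<x+ε : ∀ x {ε} → 0ℚ < ε → x < x + ε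
  x<x+ε x 0<ε = subst (_< x + _) (ℚ.+-identityʳ x) (ℚ.+-monoʳ-< x 0<ε)

  *-pos : ∀ {a b} → 0ℚ < a → 0ℚ < b → 0ℚ < a * b
  *-pos {a} {b} 0<a 0<b =
    subst (_< a * b) (ℚ.*-zeroʳ a) (ℚ.*-monoʳ-<-pos a {{ℚ.positive 0<a}} 0<b)

  *-nonneg : ∀ {a b} → 0ℚ ≤ a → 0ℚ ≤ b → 0ℚ ≤ a * b
  *-nonneg {a} {b} 0≤a 0≤b =
    subst (_≤ a * b) (ℚ.*-zeroʳ a) (ℚ.*-monoˡ-≤-nonNeg a {{ℚ.nonNegative 0≤a}} 0≤b)

  *-mono-nonneg : ∀ {a b c d} → 0ℚ ≤ b → 0ℚ ≤ c → a ≤ b → c ≤ d → a * c ≤ b * d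
  *-mono-nonneg {b = b} {c} 0≤b 0≤c a≤b c≤d = ℚ.≤-trans
    (ℚ.*-monoʳ-≤-nonNeg c {{ℚ.nonNegative 0≤c}} a≤b)
    (ℚ.*-monoˡ-≤-nonNeg b {{ℚ.nonNegative 0≤b}} c≤d)

  scale : ∀ {B ε} → 0ℚ < B → 0ℚ < ε → ∃ λ δ → 0ℚ < δ × B * δ ≡ ε
  scale {B} {ε} 0<B 0<ε = 1/ B * ε
    , *-pos (ℚ.positive⁻¹ (1/ B) {{ℚ.1/pos⇒pos B}}) 0<ε
    , trans (sym (ℚ.*-assoc B (1/ B) ε))
        (trans (cong (_* ε) (ℚ.*-inverseʳ B)) (ℚ.*-identityˡ ε))
    where instance
      B>0 : ℚ.Positive B
      B>0 = ℚ.positive 0<B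
      B≢0 : ℚ.NonZero B
      B≢0 = ℚ.pos⇒nonZero B

  x≤∣x∣ : ∀ x → x ≤ ∣ x ∣
  x≤∣x∣ x with ℚ.≤-total 0ℚ x
  ... | inj₁ 0≤x = ℚ.≤-reflexive (sym (ℚ.0≤p⇒∣p∣≡p 0≤x))
  ... | inj₂ x≤0 = ℚ.≤-trans x≤0 (ℚ.0≤∣p∣ x)

  dist-sym : ∀ a b → ∣ a - b ∣ ≡ ∣ b - a ∣
  dist-sym a b = trans (sym (ℚ.∣-p∣≡∣p∣ (a - b)))
    (cong ∣_∣ (solve 2 (λ a b → :- (a :- b) := b :- a) refl a b))

  dist⇒< : ∀ a b {ε} → ∣ a - b ∣ < ε → a < b + ε
  dist⇒< a b {ε} a~b =
    subst₂ _<_ (solve 2 (λ a b → b :+ (a :- b) := a) refl a b) refl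
      (ℚ.+-monoʳ-< b (ℚ.≤-<-trans (x≤∣x∣ (a - b)) a~b))

  <⇒dist : ∀ a b {ε} → a < b + ε → b < a + ε → ∣ a - b ∣ < ε
  <⇒dist a b {ε} a< b< with ℚ.∣p∣≡p∨∣p∣≡-p (a - b)
  ... | inj₁ eq = subst₂ _<_ (trans (ℚ.+-comm (- b) a) (sym eq))
    (solve 2 (λ b e → :- b :+ (b :+ e) := e) refl b ε) (ℚ.+-monoʳ-< (- b) a<)
  ... | inj₂ eq = subst₂ _<_
    (trans (solve 2 (λ a b → :- a :+ b := :- (a :- b)) refl a b) (sym eq))
    (solve 2 (λ a e → :- a :+ (a :+ e) := e) refl a ε) (ℚ.+-monoʳ-< (- a) b<)

  dist-+ : ∀ a b c d {ε} → ∣ a - b ∣ < ½ * ε → ∣ c - d ∣ < ½ * ε →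
           ∣ (a + c) - (b + d) ∣ < ε
  dist-+ a b c d a~b c~d = ℚ.≤-<-trans
    (subst (λ z → ∣ z ∣ ≤ ∣ a - b ∣ + ∣ c - d ∣)
      (solve 4 (λ a b c d → (a :- b) :+ (c :- d) := (a :+ c) :- (b :+ d)) refl a b c d)
      (ℚ.∣p+q∣≤∣p∣+∣q∣ (a - b) (c - d)))
    (half+half-< a~b c~d)

  dist-neg : ∀ a b → ∣ (- a) - (- b) ∣ ≡ ∣ a - b ∣
  dist-neg a b = trans
    (cong ∣_∣ (solve 2 (λ a b → (:- a) :- (:- b) := :- (a :- b)) refl a b))
    (ℚ.∣-p∣≡∣p∣ (a - b))

  dist-* : ∀ {A D ε} → 0ℚ < A → 0ℚ < D → 0ℚ < ε →
    ∃ λ δ → 0ℚ < δ × (∀ a b c d → ∣ a ∣ ≤ A → ∣ d ∣ ≤ D →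
      ∣ a - b ∣ < δ → ∣ c - d ∣ < δ → ∣ a * c - b * d ∣ < ε)
  dist-* {A} {D} {ε} 0<A 0<D 0<ε = δ , 0<δ , close
    where
    δ-spec : ∃ λ δ → 0ℚ < δ × (A + D) * δ ≡ ε
    δ-spec = scale (ℚ.+-mono-< 0<A 0<D) 0<ε
    δ = proj₁ δ-spec
    0<δ = proj₁ (proj₂ δ-spec)

    term : ∀ x y {X} → 0ℚ < X → ∣ x ∣ ≤ X → ∣ y ∣ < δ → ∣ x * y ∣ < X * δ
    term x y {X} 0<X x≤ y< = subst (_< X * δ) (sym (ℚ.∣p*q∣≡∣p∣*∣q∣ x y))
      (ℚ.≤-<-trans (ℚ.*-monoʳ-≤-nonNeg ∣ y ∣ {{ℚ.∣-∣-nonNeg y}} x≤)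
                   (ℚ.*-monoʳ-<-pos X {{ℚ.positive 0<X}} y<))

    close : ∀ a b c d → ∣ a ∣ ≤ A → ∣ d ∣ ≤ D →
      ∣ a - b ∣ < δ → ∣ c - d ∣ < δ → ∣ a * c - b * d ∣ < ε
    close a b c d a≤A d≤D a~b c~d = ℚ.≤-<-trans
      (subst (λ z → ∣ z ∣ ≤ ∣ a * (c - d) ∣ + ∣ d * (a - b) ∣)
        (solve 4 (λ a b c d → a :* (c :- d) :+ d :* (a :- b) := a :* c :- b :* d)
          refl a b c d)
        (ℚ.∣p+q∣≤∣p∣+∣q∣ (a * (c - d)) (d * (a - b))))
      (subst (∣ a * (c - d) ∣ + ∣ d * (a - b) ∣ <_)
        (trans (sym (ℚ.*-distribʳ-+ δ A D)) (proj₂ (proj₂ δ-spec)))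
        (ℚ.+-mono-< (term a (c - d) 0<A a≤A c~d) (term d (a - b) 0<D d≤D a~b)))

  /-cong : ∀ {a b} {c d} → + a ℤ.* + suc d ≡ + b ℤ.* + suc c → + a / suc c ≡ + b / suc d
  /-cong {a} {b} {c} {d} eq =
    ℚ.fromℚᵘ-cong {ℚᵘ.mkℚᵘ (+ a) c} {ℚᵘ.mkℚᵘ (+ b) d} (ℚᵘ.*≡* eq)

  cancel-suc : ∀ m k → + suc (k ℕ.+ m ℕ.* suc k) / suc k ≡ + suc m / 1
  cancel-suc m k = /-cong {suc (k ℕ.+ m ℕ.* suc k)} {suc m} {k} {0}
    (trans (ℤ.*-identityʳ _) (ℤ.pos-* (suc m) (suc k)))

  /-suc : ∀ m k → + suc m / suc k ≡ + m / suc k + + 1 / suc k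
  /-suc m k = ℚ.toℚᵘ-injective (ℚᵘ.≃-trans
    (ℚ.toℚᵘ-fromℚᵘ (ℚᵘ.mkℚᵘ (+ suc m) k))
    (ℚᵘ.≃-sym (ℚᵘ.≃-trans (ℚ.toℚᵘ-homo-+ (+ m / suc k) (+ 1 / suc k))
      (ℚᵘ.≃-trans (ℚᵘ.+-cong (ℚ.toℚᵘ-fromℚᵘ (ℚᵘ.mkℚᵘ (+ m) k))
                             (ℚ.toℚᵘ-fromℚᵘ (ℚᵘ.mkℚᵘ (+ 1) k)))
        (ℚᵘ.*≡* (trans
          (cong (ℤ._* + suc k) (trans (sym (ℤ.*-distribʳ-+ (+ suc k) (+ m) (+ 1)))
            (cong (ℤ._* + suc k) (ℤ.+-comm (+ m) (+ 1)))))
          (ℤ.*-assoc (+ suc m) (+ suc k) (+ suc k))))))))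

  0<1/suc : ∀ k → 0ℚ < + 1 / suc k
  0<1/suc k = ℚ.positive⁻¹ (+ 1 / suc k) {{ℚ.normalize-pos 1 (suc k)}}

  0≤/suc : ∀ m k → 0ℚ ≤ + m / suc k
  0≤/suc m k = ℚ.nonNegative⁻¹ (+ m / suc k) {{ℚ.normalize-nonNeg m (suc k)}}

  archimedean : ∀ x → ∃ λ m → x < + suc m / 1
  archimedean (ℚ.mkℚ z d c) = ℤ.∣ z ∣ , ℚ.toℚᵘ-cancel-< (ℚᵘ.<-respʳ-≃
    (ℚᵘ.≃-sym (ℚ.toℚᵘ-fromℚᵘ (ℚᵘ.mkℚᵘ (+ suc ℤ.∣ z ∣) 0)))
    (ℚᵘ.*<* (ℤ.≤-<-trans (ℤ.≤-reflexive (ℤ.*-identityʳ z))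
      (ℤ.≤-<-trans (i≤+∣i∣ z) (ℤ.<-≤-trans (ℤ.+<+ (ℕ.n<1+n _))
       (subst (+ suc ℤ.∣ z ∣ ℤ.≤_) (ℤ.pos-* (suc ℤ.∣ z ∣) (suc d)) (ℤ.+≤+ (ℕ.m≤m*n (suc ℤ.∣ z ∣) (suc d)))))))))
    where
    i≤+∣i∣ : ∀ i → i ℤ.≤ + ℤ.∣ i ∣
    i≤+∣i∣ (+ n) = ℤ.≤-refl
    i≤+∣i∣ (ℤ.-[1+ n ]) = ℤ.-≤+

  small : ∀ {ε} → 0ℚ < ε → ∃ λ N → ∀ k → N ℕ.≤ k → + 1 / suc k < ε
  small {ℚ.mkℚ (+ zero) d c} (ℚ.*<* (ℤ.+<+ ()))
  small {ℚ.mkℚ (ℤ.-[1+ a ]) d c} (ℚ.*<* ())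
  small {ℚ.mkℚ (+ suc a) d c} 0<ε = suc d , λ k d<k → ℚ.toℚᵘ-cancel-<
    (ℚᵘ.<-respˡ-≃ (ℚᵘ.≃-sym (ℚ.toℚᵘ-fromℚᵘ (ℚᵘ.mkℚᵘ (+ 1) k)))
      (ℚᵘ.*<* (subst₂ ℤ._<_ (sym (ℤ.*-identityˡ (+ suc d))) (ℤ.pos-* (suc a) (suc k))
        (ℤ.+<+ (ℕ.<-≤-trans (ℕ.s≤s d<k) (ℕ.m≤n*m (suc k) (suc a)))))))

open RationalLemmas

-- Real numbers are Cauchy sequences of rationals, compared by _≈_ rather
-- than _≡_.  The relation x ≤ y is equivalent to ¬ (y < x).

IsCauchy : (ℕ → ℚ) → Set
IsCauchy x = ∀ {ε} → 0ℚ ℚ.< ε →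
  ∃ λ N → ∀ i j → N ℕ.≤ i → N ℕ.≤ j → ∣ x i ℚ.- x j ∣ ℚ.< ε

record ℝ : Set where
  constructor real
  field
    seq      : ℕ → ℚ
    isCauchy : IsCauchy seq
open ℝ

infix 4 _≈_ _≤_ _<_

record _≈_ (x y : ℝ) : Set where
  constructor *≈*
  field
    close : ∀ {ε} → 0ℚ ℚ.< ε →
      ∃ λ N → ∀ k → N ℕ.≤ k → ∣ seq x k ℚ.- seq y k ∣ ℚ.< ε
open _≈_

record _≤_ (x y : ℝ) : Set where
  constructor *≤*
  field
    upTo : ∀ {ε} → 0ℚ ℚ.< ε →
      ∃ λ N → ∀ k → N ℕ.≤ k → seq x k ℚ.< seq y k ℚ.+ ε
open _≤_

record _<_ (x y : ℝ) : Set where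
  constructor *<*
  field
    separated : ∃ λ ε → 0ℚ ℚ.< ε ×
      ∃ λ N → ∀ k → N ℕ.≤ k → seq x k ℚ.+ ε ℚ.≤ seq y k

tail-bounded : ∀ x →
  ∃ λ B → 0ℚ ℚ.< B × ∃ λ N → ∀ i → N ℕ.≤ i → ∣ seq x i ∣ ℚ.≤ B
tail-bounded x = B , 0<B , N , bound
  where
  N = proj₁ (isCauchy x {1ℚ} (ℚ.positive⁻¹ 1ℚ))
  close-N = proj₂ (isCauchy x {1ℚ} (ℚ.positive⁻¹ 1ℚ))

  B : ℚ
  B = 1ℚ ℚ.+ ∣ seq x N ∣

  0<B : 0ℚ ℚ.< B
  0<B = ℚ.+-mono-<-≤ (ℚ.positive⁻¹ 1ℚ) (ℚ.0≤∣p∣ (seq x N))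

  bound : ∀ i → N ℕ.≤ i → ∣ seq x i ∣ ℚ.≤ B
  bound i N≤i = ℚ.≤-trans
    (subst (λ z → ∣ z ∣ ℚ.≤ ∣ seq x i ℚ.- seq x N ∣ ℚ.+ ∣ seq x N ∣)
      (solve 2 (λ a b → (a :- b) :+ b := a) refl (seq x i) (seq x N))
      (ℚ.∣p+q∣≤∣p∣+∣q∣ (seq x i ℚ.- seq x N) (seq x N)))
    (ℚ.+-monoˡ-≤ ∣ seq x N ∣ (ℚ.<⇒≤ (close-N i N N≤i ℕ.≤-refl)))
    where open +-*-Solver

infixl 6 _+_ _-_
infixl 7 _*_
infix  8 -_

abstract
  const-isCauchy : ∀ a → IsCauchy (λ _ → a)
  const-isCauchy a 0<ε =
    0 , λ _ _ _ _ → subst (ℚ._< _) (sym (cong ∣_∣ (ℚ.+-inverseʳ a))) 0<ε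

  +-isCauchy : ∀ x y → IsCauchy (λ k → seq x k ℚ.+ seq y k)
  +-isCauchy x y 0<ε =
    let M , close-x = isCauchy x (half-pos 0<ε)
        N , close-y = isCauchy y (half-pos 0<ε)
    in M ℕ.⊔ N , λ i j i≥ j≥ →
      dist-+ (seq x i) (seq x j) (seq y i) (seq y j)
        (close-x i j (ℕ.m⊔n≤o⇒m≤o M N i≥) (ℕ.m⊔n≤o⇒m≤o M N j≥))
        (close-y i j (ℕ.m⊔n≤o⇒n≤o M N i≥) (ℕ.m⊔n≤o⇒n≤o M N j≥))

  neg-isCauchy : ∀ x → IsCauchy (λ k → ℚ.- seq x k)
  neg-isCauchy x 0<ε =
    let N , close-x = isCauchy x 0<ε
    in N , λ i j i≥ j≥ →
      subst (ℚ._< _) (sym (dist-neg (seq x i) (seq x j))) (close-x i j i≥ j≥)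

  *-isCauchy : ∀ x y → IsCauchy (λ k → seq x k ℚ.* seq y k)
  *-isCauchy x y 0<ε =
    let A , 0<A , L , x≤A = tail-bounded x
        D , 0<D , M , y≤D = tail-bounded y
        δ , 0<δ , close-* = dist-* 0<A 0<D 0<ε
        N , close-x       = isCauchy x 0<δ
        O , close-y       = isCauchy y 0<δ
    in (L ℕ.⊔ M) ℕ.⊔ (N ℕ.⊔ O) , λ i j i≥ j≥ →
      let i≥LM = ℕ.m⊔n≤o⇒m≤o (L ℕ.⊔ M) _ i≥
          j≥LM = ℕ.m⊔n≤o⇒m≤o (L ℕ.⊔ M) _ j≥
          i≥NO = ℕ.m⊔n≤o⇒n≤o (L ℕ.⊔ M) _ i≥
          j≥NO = ℕ.m⊔n≤o⇒n≤o (L ℕ.⊔ M) _ j≥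
      in close-* (seq x i) (seq x j) (seq y i) (seq y j)
        (x≤A i (ℕ.m⊔n≤o⇒m≤o L M i≥LM)) (y≤D j (ℕ.m⊔n≤o⇒n≤o L M j≥LM))
        (close-x i j (ℕ.m⊔n≤o⇒m≤o N O i≥NO) (ℕ.m⊔n≤o⇒m≤o N O j≥NO))
        (close-y i j (ℕ.m⊔n≤o⇒n≤o N O i≥NO) (ℕ.m⊔n≤o⇒n≤o N O j≥NO))

fromℚ : ℚ → ℝ
fromℚ a = real (λ _ → a) (const-isCauchy a)

fromℤ : ℤ → ℝ
fromℤ z = fromℚ (z ℚ./ 1)

fromℕ : ℕ → ℝ
fromℕ n = fromℤ (+ n)

_+_ _*_ : ℝ → ℝ → ℝ
x + y = real (λ k → seq x k ℚ.+ seq y k) (+-isCauchy x y)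
x * y = real (λ k → seq x k ℚ.* seq y k) (*-isCauchy x y)

-_ : ℝ → ℝ
- x = real (λ k → ℚ.- seq x k) (neg-isCauchy x)

_-_ : ℝ → ℝ → ℝ
x - y = x + (- y)

ℝ-rawRing : RawRing 0ℓ 0ℓ
ℝ-rawRing = record
  { Carrier = ℝ ; _≈_ = _≈_ ; _+_ = _+_ ; _*_ = _*_ ; -_ = -_
  ; 0# = fromℚ 0ℚ ; 1# = fromℚ 1ℚ }

≈-refl : ∀ {x} → x ≈ x
≈-refl {x} = *≈* λ 0<ε →
  0 , λ k _ → subst (ℚ._< _) (sym (cong ∣_∣ (ℚ.+-inverseʳ (seq x k)))) 0<ε

+-cong : ∀ {x y u v} → x ≈ y → u ≈ v → x + u ≈ y + v
+-cong {x} {y} {u} {v} x≈y u≈v = *≈* λ 0<ε →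
  let M , close-x = close x≈y (half-pos 0<ε)
      N , close-u = close u≈v (half-pos 0<ε)
  in M ℕ.⊔ N , λ k k≥ →
    dist-+ (seq x k) (seq y k) (seq u k) (seq v k)
      (close-x k (ℕ.m⊔n≤o⇒m≤o M N k≥)) (close-u k (ℕ.m⊔n≤o⇒n≤o M N k≥))

-‿cong : ∀ {x y} → x ≈ y → - x ≈ - y
-‿cong {x} {y} x≈y = *≈* λ 0<ε →
  let N , close-x = close x≈y 0<ε
  in N , λ k k≥ → subst (ℚ._< _) (sym (dist-neg (seq x k) (seq y k))) (close-x k k≥)

*-cong : ∀ {x y u v} → x ≈ y → u ≈ v → x * u ≈ y * v
*-cong {x} {y} {u} {v} x≈y u≈v = *≈* λ 0<ε →
  let A , 0<A , L , x≤A = tail-bounded x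
      D , 0<D , M , v≤D = tail-bounded v
      δ , 0<δ , close-* = dist-* 0<A 0<D 0<ε
      N , close-x       = close x≈y 0<δ
      O , close-u       = close u≈v 0<δ
  in (L ℕ.⊔ M) ℕ.⊔ (N ℕ.⊔ O) , λ k k≥ →
    let k≥LM = ℕ.m⊔n≤o⇒m≤o (L ℕ.⊔ M) _ k≥
        k≥NO = ℕ.m⊔n≤o⇒n≤o (L ℕ.⊔ M) _ k≥
    in close-* (seq x k) (seq y k) (seq u k) (seq v k)
      (x≤A k (ℕ.m⊔n≤o⇒m≤o L M k≥LM)) (v≤D k (ℕ.m⊔n≤o⇒n≤o L M k≥LM))
      (close-x k (ℕ.m⊔n≤o⇒m≤o N O k≥NO)) (close-u k (ℕ.m⊔n≤o⇒n≤o N O k≥NO))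

-- The largest m ≤ M with g m ≤ y, or 0 if there is none.
search : (ℕ → ℚ) → ℕ → ℚ → ℕ
search g zero    y = 0
search g (suc M) y with g (suc M) ℚ.≤? y
... | yes _ = suc M
... | no  _ = search g M y

search-lower : ∀ (g : ℕ → ℚ) M y → search g M y ≡ 0 ⊎ g (search g M y) ℚ.≤ y
search-lower g zero    y = inj₁ refl
search-lower g (suc M) y with g (suc M) ℚ.≤? y
... | yes g≤y = inj₂ g≤y
... | no  _   = search-lower g M y

search-upper : ∀ (g : ℕ → ℚ) M y → y ℚ.< g (suc M) → y ℚ.< g (suc (search g M y))
search-upper g zero    y y< = y<
search-upper g (suc M) y y< with g (suc M) ℚ.≤? y
... | yes _   = y<
... | no  g≰y = search-upper g M y (ℚ.≰⇒> g≰y)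

-- A quantitative form of "f is strictly increasing and unbounded on
-- [lo, ∞)", as needed to invert f without classical logic.
record Increasing (lo : ℚ) (f : ℚ → ℚ) : Set where
  field
    gap       : ∀ {ε} → 0ℚ ℚ.< ε → ∃ λ δ → 0ℚ ℚ.< δ ×
                  (∀ a → lo ℚ.≤ a → f a ℚ.+ δ ℚ.≤ f (a ℚ.+ ε))
    unbounded : ∀ y → ∃ λ m → y ℚ.< f (lo ℚ.+ + suc m ℚ./ 1)

-- F respects _≈_ and acts on Cauchy sequences by applying f termwise.
record Extends (f : ℚ → ℚ) (F : ℝ → ℝ) : Set where
  field
    F-cong   : ∀ {x y} → x ≈ y → F x ≈ F y
    termwise : ∀ x k → seq (F x) k ≡ f (seq x k)

module Inverse {lo : ℚ} {f : ℚ → ℚ} (inc : Increasing lo f) where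
  open Increasing inc

  strict-mono : ∀ {a b} → lo ℚ.≤ a → a ℚ.< b → f a ℚ.< f b
  strict-mono {a} {b} lo≤a a<b =
    let δ , 0<δ , f+δ≤ = gap {b ℚ.- a} (subst (ℚ._< b ℚ.- a) (ℚ.+-inverseʳ a) (ℚ.+-monoˡ-< (ℚ.- a) a<b))
    in ℚ.<-≤-trans (x<x+ε (f a) 0<δ)
         (subst (λ c → f a ℚ.+ δ ℚ.≤ f c) (solve 2 (λ a b → a :+ (b :- a) := b) refl a b)
           (f+δ≤ a lo≤a))
    where open +-*-Solver

  mono : ∀ {a b} → lo ℚ.≤ a → a ℚ.≤ b → f a ℚ.≤ f b
  mono {a} {b} lo≤a a≤b with a ℚ.<? b
  ... | yes a<b = ℚ.<⇒≤ (strict-mono lo≤a a<b)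
  ... | no  a≮b = ℚ.≤-reflexive (cong f (ℚ.≤-antisym a≤b (ℚ.≮⇒≥ a≮b)))

  below : ∀ {a y ε} → a ≡ lo ⊎ f a ℚ.≤ y → 0ℚ ℚ.< ε → f lo ℚ.< y ℚ.+ ε → f a ℚ.< y ℚ.+ ε
  below (inj₁ refl) 0<ε flo< = flo<
  below (inj₂ fa≤y) 0<ε flo< = ℚ.≤-<-trans fa≤y (x<x+ε _ 0<ε)

  nearby : ∀ {ε} → 0ℚ ℚ.< ε → ∃ λ δ → 0ℚ ℚ.< δ ×
    (∀ a b h y z → a ≡ lo ⊎ f a ℚ.≤ y → lo ℚ.≤ b → z ℚ.< f (b ℚ.+ h) →
      0ℚ ℚ.< h → h ℚ.< ½ ℚ.* ε → y ℚ.< z ℚ.+ δ → a ℚ.< b ℚ.+ ε)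
  nearby {ε} 0<ε = δ , 0<δ , close′
    where
    gap½ = gap (half-pos 0<ε)
    δ = proj₁ gap½
    0<δ = proj₁ (proj₂ gap½)

    close′ : ∀ a b h y z → a ≡ lo ⊎ f a ℚ.≤ y → lo ℚ.≤ b → z ℚ.< f (b ℚ.+ h) →
      0ℚ ℚ.< h → h ℚ.< ½ ℚ.* ε → y ℚ.< z ℚ.+ δ → a ℚ.< b ℚ.+ ε
    close′ a b h y z (inj₁ refl) lo≤b z< 0<h h<½ε y<z+δ = ℚ.≤-<-trans lo≤b (x<x+ε b 0<ε)
    close′ a b h y z (inj₂ fa≤y) lo≤b z< 0<h h<½ε y<z+δ with a ℚ.<? b ℚ.+ ε
    ... | yes a<b+ε = a<b+ε
    ... | no  a≮b+ε = contradiction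
      (ℚ.<-≤-trans (ℚ.<-≤-trans y<z+δ z+δ≤fa) fa≤y) (ℚ.<-irrefl refl)
      where
      lo≤b+h : lo ℚ.≤ b ℚ.+ h
      lo≤b+h = ℚ.≤-trans lo≤b (ℚ.<⇒≤ (x<x+ε b 0<h))

      b+h+½ε≤a : b ℚ.+ h ℚ.+ ½ ℚ.* ε ℚ.≤ a
      b+h+½ε≤a = ℚ.≤-trans
        (ℚ.≤-reflexive (ℚ.+-assoc b h (½ ℚ.* ε)))
        (ℚ.≤-trans
          (ℚ.+-monoʳ-≤ b
            (ℚ.≤-trans (ℚ.+-monoˡ-≤ (½ ℚ.* ε) (ℚ.<⇒≤ h<½ε)) (ℚ.≤-reflexive (half+half ε))))
          (ℚ.≮⇒≥ a≮b+ε))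

      z+δ≤fa : z ℚ.+ δ ℚ.≤ f a
      z+δ≤fa = ℚ.≤-trans (ℚ.+-monoˡ-≤ δ (ℚ.<⇒≤ z<))
        (ℚ.≤-trans (proj₂ (proj₂ gap½) (b ℚ.+ h) lo≤b+h)
          (mono (ℚ.≤-trans lo≤b+h (ℚ.<⇒≤ (x<x+ε (b ℚ.+ h) (half-pos 0<ε)))) b+h+½ε≤a))

  step : ℕ → ℚ
  step k = + 1 ℚ./ suc k

  grid : ℕ → ℕ → ℚ
  grid k m = lo ℚ.+ + m ℚ./ suc k

  -- suc (limit k y) is (suc m) * (suc k) for the m bounding y, so the
  -- search covers the grid up to lo + suc m.
  limit : ℕ → ℚ → ℕ
  limit k y = k ℕ.+ proj₁ (unbounded y) ℕ.* suc k

  index : ℕ → ℚ → ℕ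
  index k y = search (λ m → f (grid k m)) (limit k y) y

  approx : ℕ → ℚ → ℚ
  approx k y = grid k (index k y)

  grid-0 : ∀ k → grid k 0 ≡ lo
  grid-0 k = trans (cong (lo ℚ.+_) (/-cong {0} {0} {k} {0} refl)) (ℚ.+-identityʳ lo)

  grid-suc : ∀ k m → grid k (suc m) ≡ grid k m ℚ.+ step k
  grid-suc k m = trans (cong (lo ℚ.+_) (/-suc m k))
    (sym (ℚ.+-assoc lo (+ m ℚ./ suc k) (step k)))

  lo≤approx : ∀ k y → lo ℚ.≤ approx k y
  lo≤approx k y = ℚ.≤-trans (ℚ.≤-reflexive (sym (ℚ.+-identityʳ lo)))
    (ℚ.+-monoʳ-≤ lo (0≤/suc (index k y) k))

  approx-lower : ∀ k y → approx k y ≡ lo ⊎ f (approx k y) ℚ.≤ y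
  approx-lower k y = Sum.map₁
    (λ m≡0 → trans (cong (grid k) m≡0) (grid-0 k))
    (search-lower (λ m → f (grid k m)) (limit k y) y)

  approx-upper : ∀ k y → y ℚ.< f (approx k y ℚ.+ step k)
  approx-upper k y = subst (λ a → y ℚ.< f a) (grid-suc k (index k y))
    (search-upper (λ m → f (grid k m)) (limit k y) y
      (subst (λ a → y ℚ.< f (lo ℚ.+ a)) (sym (cancel-suc (proj₁ (unbounded y)) k))
        (proj₂ (unbounded y))))

  abstract
    inverse-isCauchy : ∀ y → IsCauchy (λ k → approx k (seq y k))
    inverse-isCauchy y {ε} 0<ε =
      let δ , 0<δ , close′ = nearby 0<ε
          M , close-y = isCauchy y 0<δ
          N , step<   = small (half-pos 0<ε)
          bound : ∀ i j → M ℕ.⊔ N ℕ.≤ i → M ℕ.⊔ N ℕ.≤ j →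
                  approx i (seq y i) ℚ.< approx j (seq y j) ℚ.+ ε
          bound i j i≥ j≥ =
            close′ (approx i (seq y i)) (approx j (seq y j)) (step j) (seq y i) (seq y j)
              (approx-lower i (seq y i)) (lo≤approx j (seq y j)) (approx-upper j (seq y j))
              (0<1/suc j) (step< j (ℕ.m⊔n≤o⇒n≤o M N j≥))
              (dist⇒< (seq y i) (seq y j)
                (close-y i j (ℕ.m⊔n≤o⇒m≤o M N i≥) (ℕ.m⊔n≤o⇒m≤o M N j≥)))
      in M ℕ.⊔ N , λ i j i≥ j≥ →
        <⇒dist (approx i (seq y i)) (approx j (seq y j)) (bound i j i≥ j≥) (bound j i j≥ i≥)

    step-isCauchy : IsCauchy step
    step-isCauchy {ε} 0<ε =
      let N , step< = small 0<ε
          bound : ∀ i j → N ℕ.≤ i → step i ℚ.< step j ℚ.+ ε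
          bound i j i≥ = ℚ.<-≤-trans (step< i i≥)
            (ℚ.≤-trans (ℚ.≤-reflexive (sym (ℚ.+-identityˡ ε)))
              (ℚ.+-monoˡ-≤ ε (ℚ.<⇒≤ (0<1/suc j))))
      in N , λ i j i≥ j≥ → <⇒dist (step i) (step j) (bound i j i≥) (bound j i j≥)

  -- The inverse of f on [lo, ∞), extended to real arguments; it is lo
  -- below f lo.  The k-th term searches a grid of mesh 1 / (k + 1).
  inverse : ℝ → ℝ
  inverse y = real (λ k → approx k (seq y k)) (inverse-isCauchy y)

  lo≤inverse : ∀ y → fromℚ lo ≤ inverse y
  lo≤inverse y = *≤* λ 0<ε → 0 , λ k _ →
    ℚ.≤-<-trans (lo≤approx k (seq y k)) (x<x+ε (approx k (seq y k)) 0<ε)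

  steps : ℝ
  steps = real step step-isCauchy

  x+steps≈x : ∀ x → x + steps ≈ x
  x+steps≈x x = *≈* λ {ε} 0<ε →
    let N , step< = small 0<ε
    in N , λ k k≥ → <⇒dist (seq x k ℚ.+ step k) (seq x k)
      (ℚ.+-monoʳ-< (seq x k) (step< k k≥))
      (ℚ.<-trans (x<x+ε (seq x k) (0<1/suc k)) (x<x+ε (seq x k ℚ.+ step k) 0<ε))

  inverse-correct : ∀ {F} → Extends f F →
    ∀ {y} → fromℚ (f lo) ≤ y → F (inverse y) ≈ y
  inverse-correct {F} F-ext {y} flo≤y = *≈* λ {ε} 0<ε →
    let x = inverse y
        M , close-x = close (F-cong (x+steps≈x x)) 0<ε
        N , flo<    = upTo flo≤y 0<ε
    in M ℕ.⊔ N , λ k k≥ →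
      <⇒dist (seq (F x) k) (seq y k)
        (subst (ℚ._< seq y k ℚ.+ ε) (sym (termwise x k))
          (below (approx-lower k (seq y k)) 0<ε (flo< k (ℕ.m⊔n≤o⇒n≤o M N k≥))))
        (ℚ.<-trans (approx-upper k (seq y k))
          (subst (ℚ._< seq (F x) k ℚ.+ ε) (termwise (x + steps) k)
            (dist⇒< (seq (F (x + steps)) k) (seq (F x) k)
              (close-x k (ℕ.m⊔n≤o⇒m≤o M N k≥)))))
    where open Extends F-ext

open Inverse using (inverse; lo≤inverse; inverse-correct)

open Polynomials ℝ-rawRing public

module Extension where
  open Extends

  infixl 6 _⊕_ _⊖_
  infixl 7 _⊗_
  infixr 8 _⊙_ _⊛_

  var : Extends (λ a → a) (λ x → x)
  var = record { F-cong = λ x≈y → x≈y ; termwise = λ _ _ → refl }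

  const : ∀ c → Extends (λ _ → c) (λ _ → fromℚ c)
  const c = record { F-cong = λ _ → ≈-refl ; termwise = λ _ _ → refl }

  _⊕_ : ∀ {f F g G} → Extends f F → Extends g G →
        Extends (λ a → f a ℚ.+ g a) (λ x → F x + G x)
  e ⊕ d = record
    { F-cong   = λ x≈y → +-cong (F-cong e x≈y) (F-cong d x≈y)
    ; termwise = λ x k → cong₂ ℚ._+_ (termwise e x k) (termwise d x k) }

  _⊖_ : ∀ {f F g G} → Extends f F → Extends g G →
        Extends (λ a → f a ℚ.- g a) (λ x → F x - G x)
  e ⊖ d = record
    { F-cong   = λ x≈y → +-cong (F-cong e x≈y) (-‿cong (F-cong d x≈y))
    ; termwise = λ x k → cong₂ ℚ._-_ (termwise e x k) (termwise d x k) }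

  _⊗_ : ∀ {f F g G} → Extends f F → Extends g G →
        Extends (λ a → f a ℚ.* g a) (λ x → F x * G x)
  e ⊗ d = record
    { F-cong   = λ x≈y → *-cong (F-cong e x≈y) (F-cong d x≈y)
    ; termwise = λ x k → cong₂ ℚ._*_ (termwise e x k) (termwise d x k) }

  _⊙_ : ∀ m {f F} → Extends f F → Extends (λ a → m Polyℚ.· f a) (λ x → m · F x)
  zero  ⊙ e = const 0ℚ
  suc m ⊙ e = e ⊕ m ⊙ e

  _⊛_ : ∀ {f F} → Extends f F → ∀ m → Extends (λ a → f a Polyℚ.^ m) (λ x → F x ^ m)
  e ⊛ zero  = const 1ℚ
  e ⊛ suc m = e ⊗ (e ⊛ m)

  N₂-ext : Extends Polyℚ.N₂ N₂
  N₂-ext = 4 ⊙ (var ⊛ 5) ⊖ 7 ⊙ (var ⊛ 4) ⊕ 7 ⊙ (var ⊛ 3) ⊖ 4 ⊙ (var ⊛ 2) ⊕ var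

  n₂-ext : Extends Polyℚ.n₂ n₂
  n₂-ext = (var ⊛ 2 ⊕ var ⊕ const 1ℚ)
    ⊗ (2 ⊙ (var ⊛ 4) ⊕ 3 ⊙ (var ⊛ 3) ⊕ 3 ⊙ (var ⊛ 2) ⊕ 2 ⊙ var ⊕ const 1ℚ)
    ⊗ (2 ⊙ (var ⊛ 4) ⊕ 5 ⊙ (var ⊛ 3) ⊕ 6 ⊙ (var ⊛ 2) ⊕ 3 ⊙ var ⊕ const 1ℚ)

-- N₂ on [1, ∞), n₂ on [0, ∞) and the powers on [0, ∞) are increasing:
-- each is of the form f (lo + t) = f lo + g t with g superadditive.

record Superadditive (g : ℚ → ℚ) : Set where
  field
    nonneg : ∀ {t} → 0ℚ ℚ.≤ t → 0ℚ ℚ.≤ g t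
    pos    : ∀ {t} → 0ℚ ℚ.< t → 0ℚ ℚ.< g t
    super  : ∀ {s t} → 0ℚ ℚ.≤ s → 0ℚ ℚ.≤ t → g s ℚ.+ g t ℚ.≤ g (s ℚ.+ t)

module Superadd where
  open Superadditive
  open +-*-Solver using (solve; _:=_; _:+_; _:*_; _:-_; con; Polynomial)

  -- The polynomials as syntax for the ring solver, whose evaluation
  -- is definitionally Polyℚ.
  module SolverPolynomials where
    open +-*-Solver using (_:+_; _:*_; :-_; con; Polynomial)
    syntaxRing : RawRing 0ℓ 0ℓ
    syntaxRing = record
      { Carrier = Polynomial 1 ; _≈_ = _≡_ ; _+_ = _:+_ ; _*_ = _:*_ ; -_ = :-_
      ; 0# = con 0ℚ ; 1# = con 1ℚ }
    open Polynomials syntaxRing public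
      using () renaming (N₂ to N₂ˢ; n₂ to n₂ˢ; _·_ to infixr 8 _·ˢ_; _^_ to infixr 8 _^ˢ_)

  infixl 6 _⊕_
  infixl 7 _⊗_
  infixr 8 _⊙_ _⊛_

  +-nonneg : ∀ {a b} → 0ℚ ℚ.≤ a → 0ℚ ℚ.≤ b → 0ℚ ℚ.≤ a ℚ.+ b
  +-nonneg = ℚ.+-mono-≤

  var : Superadditive (λ t → t)
  var = record { nonneg = λ 0≤t → 0≤t ; pos = λ 0<t → 0<t ; super = λ _ _ → ℚ.≤-refl }

  ext : ∀ {g h} → (∀ t → g t ≡ h t) → Superadditive g → Superadditive h
  ext g≡h a = record
    { nonneg = λ {t} 0≤t → subst (0ℚ ℚ.≤_) (g≡h t) (nonneg a 0≤t)
    ; pos    = λ {t} 0<t → subst (0ℚ ℚ.<_) (g≡h t) (pos a 0<t)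
    ; super  = λ {s} {t} 0≤s 0≤t →
        subst₂ ℚ._≤_ (cong₂ ℚ._+_ (g≡h s) (g≡h t)) (g≡h (s ℚ.+ t)) (super a 0≤s 0≤t) }

  _⊕_ : ∀ {g h} → Superadditive g → Superadditive h → Superadditive (λ t → g t ℚ.+ h t)
  _⊕_ {g} {h} a b = record
    { nonneg = λ 0≤t → +-nonneg (nonneg a 0≤t) (nonneg b 0≤t)
    ; pos    = λ 0<t → ℚ.+-mono-< (pos a 0<t) (pos b 0<t)
    ; super  = λ {s} {t} 0≤s 0≤t → ℚ.≤-trans
        (ℚ.≤-reflexive (solve 4 (λ gs gt hs ht →
          (gs :+ hs) :+ (gt :+ ht) := (gs :+ gt) :+ (hs :+ ht)) refl (g s) (g t) (h s) (h t)))
        (ℚ.+-mono-≤ (super a 0≤s 0≤t) (super b 0≤s 0≤t)) }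

  _⊗_ : ∀ {g h} → Superadditive g → Superadditive h → Superadditive (λ t → g t ℚ.* h t)
  _⊗_ {g} {h} a b = record
    { nonneg = λ 0≤t → *-nonneg (nonneg a 0≤t) (nonneg b 0≤t)
    ; pos    = λ 0<t → *-pos (pos a 0<t) (pos b 0<t)
    ; super  = λ {s} {t} 0≤s 0≤t → ℚ.≤-trans (ℚ.≤-trans
        (ℚ.≤-reflexive (sym (ℚ.+-identityʳ _)))
        (ℚ.≤-trans
          (ℚ.+-monoʳ-≤ (g s ℚ.* h s ℚ.+ g t ℚ.* h t)
            (+-nonneg (*-nonneg (nonneg a 0≤s) (nonneg b 0≤t))
                      (*-nonneg (nonneg a 0≤t) (nonneg b 0≤s))))
          (ℚ.≤-reflexive (solve 4 (λ gs gt hs ht →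
            (gs :* hs :+ gt :* ht) :+ (gs :* ht :+ gt :* hs) := (gs :+ gt) :* (hs :+ ht))
            refl (g s) (g t) (h s) (h t)))))
        (*-mono-nonneg (ℚ.≤-trans (+-nonneg (nonneg a 0≤s) (nonneg a 0≤t)) (super a 0≤s 0≤t))
          (+-nonneg (nonneg b 0≤s) (nonneg b 0≤t)) (super a 0≤s 0≤t) (super b 0≤s 0≤t)) }

  _⊙_ : ∀ m {g} → Superadditive g → Superadditive (λ t → suc m Polyℚ.· g t)
  zero  ⊙ a = ext (λ t → sym (ℚ.+-identityʳ _)) a
  suc m ⊙ a = a ⊕ (m ⊙ a)

  _⊛_ : ∀ {g} → Superadditive g → ∀ m → Superadditive (λ t → g t Polyℚ.^ suc m)
  a ⊛ zero  = ext (λ t → sym (ℚ.*-identityʳ _)) a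
  a ⊛ suc m = a ⊗ (a ⊛ m)

  above-id : ∀ {g} → Superadditive g → 1ℚ ℚ.≤ g 1ℚ → ∀ m → + suc m ℚ./ 1 ℚ.≤ g (+ suc m ℚ./ 1)
  above-id a 1≤g1 zero    = 1≤g1
  above-id {g} a 1≤g1 (suc m) = subst (λ c → c ℚ.≤ g c) (sym (/-suc (suc m) 0))
    (ℚ.≤-trans (ℚ.+-mono-≤ (above-id a 1≤g1 m) 1≤g1)
      (super a (0≤/suc (suc m) 0) (0≤/suc 1 0)))

  increasing : ∀ {lo f g} → (∀ t → f (lo ℚ.+ t) ≡ f lo ℚ.+ g t) →
    Superadditive g → 1ℚ ℚ.≤ g 1ℚ → Increasing lo f
  increasing {lo} {f} {g} f≡ a 1≤g1 = record { gap = gap ; unbounded = unbounded }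
    where
    gap : ∀ {ε} → 0ℚ ℚ.< ε → ∃ λ δ → 0ℚ ℚ.< δ ×
          (∀ x → lo ℚ.≤ x → f x ℚ.+ δ ℚ.≤ f (x ℚ.+ ε))
    gap {ε} 0<ε = g ε , pos a 0<ε , λ x lo≤x →
      let t   = x ℚ.- lo
          0≤t = subst (ℚ._≤ t) (ℚ.+-inverseʳ lo) (ℚ.+-monoˡ-≤ (ℚ.- lo) lo≤x)
      in subst₂ ℚ._≤_
        (trans (sym (ℚ.+-assoc (f lo) (g t) (g ε)))
          (cong (ℚ._+ g ε) (trans (sym (f≡ t))
            (cong f (solve 2 (λ lo x → lo :+ (x :- lo) := x) refl lo x)))))
        (trans (sym (f≡ (t ℚ.+ ε)))
          (cong f (solve 3 (λ lo x e → lo :+ (x :- lo :+ e) := x :+ e) refl lo x ε)))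
        (ℚ.+-monoʳ-≤ (f lo) (super a 0≤t (ℚ.<⇒≤ 0<ε)))

    unbounded : ∀ y → ∃ λ m → y ℚ.< f (lo ℚ.+ + suc m ℚ./ 1)
    unbounded y =
      let m , y-flo< = archimedean (y ℚ.- f lo)
      in m , subst (y ℚ.<_) (sym (f≡ (+ suc m ℚ./ 1)))
        (ℚ.<-≤-trans
          (subst (ℚ._< f lo ℚ.+ + suc m ℚ./ 1)
            (solve 2 (λ y c → c :+ (y :- c) := y) refl y (f lo))
            (ℚ.+-monoʳ-< (f lo) y-flo<))
          (ℚ.+-monoʳ-≤ (f lo) (above-id a 1≤g1 m)))

  N₂-increasing : Increasing 1ℚ Polyℚ.N₂
  N₂-increasing = increasing N₂-shift
    (5 ⊙ var ⊕ 14 ⊙ (var ⊛ 1) ⊕ 18 ⊙ (var ⊛ 2) ⊕ 12 ⊙ (var ⊛ 3) ⊕ 3 ⊙ (var ⊛ 4))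
    (toWitness {a? = 1ℚ ℚ.≤? _} _)
    where
    open SolverPolynomials
    open Polyℚ using () renaming (_·_ to infixr 8 _·ᵠ_; _^_ to infixr 8 _^ᵠ_)
    N₂-shift : ∀ t → Polyℚ.N₂ (1ℚ ℚ.+ t) ≡ Polyℚ.N₂ 1ℚ ℚ.+
      (6 ·ᵠ t ℚ.+ 15 ·ᵠ t ^ᵠ 2 ℚ.+ 19 ·ᵠ t ^ᵠ 3 ℚ.+ 13 ·ᵠ t ^ᵠ 4
      ℚ.+ 4 ·ᵠ t ^ᵠ 5)
    N₂-shift = solve 1 (λ t → N₂ˢ (con 1ℚ :+ t) := N₂ˢ (con 1ℚ) :+
      (6 ·ˢ t :+ 15 ·ˢ t ^ˢ 2 :+ 19 ·ˢ t ^ˢ 3 :+ 13 ·ˢ t ^ˢ 4 :+ 4 ·ˢ t ^ˢ 5)) refl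

  n₂-increasing : Increasing 0ℚ Polyℚ.n₂
  n₂-increasing = increasing n₂-shift
    (5 ⊙ var ⊕ 20 ⊙ (var ⊛ 1) ⊕ 48 ⊙ (var ⊛ 2) ⊕ 84 ⊙ (var ⊛ 3) ⊕ 112 ⊙ (var ⊛ 4)
      ⊕ 116 ⊙ (var ⊛ 5) ⊕ 91 ⊙ (var ⊛ 6) ⊕ 52 ⊙ (var ⊛ 7) ⊕ 19 ⊙ (var ⊛ 8) ⊕ 3 ⊙ (var ⊛ 9))
    (toWitness {a? = 1ℚ ℚ.≤? _} _)
    where
    open SolverPolynomials
    open Polyℚ using () renaming (_·_ to infixr 8 _·ᵠ_; _^_ to infixr 8 _^ᵠ_)
    n₂-shift : ∀ t → Polyℚ.n₂ (0ℚ ℚ.+ t) ≡ Polyℚ.n₂ 0ℚ ℚ.+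
      (6 ·ᵠ t ℚ.+ 21 ·ᵠ t ^ᵠ 2 ℚ.+ 49 ·ᵠ t ^ᵠ 3 ℚ.+ 85 ·ᵠ t ^ᵠ 4
      ℚ.+ 113 ·ᵠ t ^ᵠ 5 ℚ.+ 117 ·ᵠ t ^ᵠ 6 ℚ.+ 92 ·ᵠ t ^ᵠ 7 ℚ.+ 53 ·ᵠ t ^ᵠ 8
      ℚ.+ 20 ·ᵠ t ^ᵠ 9 ℚ.+ 4 ·ᵠ t ^ᵠ 10)
    n₂-shift = solve 1 (λ t → n₂ˢ (con 0ℚ :+ t) := n₂ˢ (con 0ℚ) :+
      (6 ·ˢ t :+ 21 ·ˢ t ^ˢ 2 :+ 49 ·ˢ t ^ˢ 3 :+ 85 ·ˢ t ^ˢ 4 :+ 113 ·ˢ t ^ˢ 5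
        :+ 117 ·ˢ t ^ˢ 6 :+ 92 ·ˢ t ^ˢ 7 :+ 53 ·ˢ t ^ˢ 8 :+ 20 ·ˢ t ^ˢ 9 :+ 4 ·ˢ t ^ˢ 10)) refl

  ^-increasing : ∀ m → Increasing 0ℚ (Polyℚ._^ suc m)
  ^-increasing m = increasing
    (λ t → trans (cong (Polyℚ._^ suc m) (ℚ.+-identityˡ t))
      (trans (sym (ℚ.+-identityˡ _)) (cong (ℚ._+ t Polyℚ.^ suc m) (sym (ℚ.*-zeroˡ (0ℚ Polyℚ.^ m))))))
    (var ⊛ m) (ℚ.≤-reflexive (sym (1^ m)))
    where
    1^ : ∀ m → 1ℚ Polyℚ.^ suc m ≡ 1ℚ
    1^ zero    = refl
    1^ (suc m) = trans (ℚ.*-identityˡ _) (1^ m)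

N₂⁻¹ n₂⁻¹ : ℝ → ℝ
N₂⁻¹ = inverse Superadd.N₂-increasing
n₂⁻¹ = inverse Superadd.n₂-increasing

-- The non-negative m-th root; 0 on negative arguments.
root : (m : ℕ) .{{_ : ℕ.NonZero m}} → ℝ → ℝ
root (suc m) = inverse (Superadd.^-increasing m)

√_ : ℝ → ℝ
√ x = root 2 x

1≤N₂⁻¹ : ∀ y → fromℚ 1ℚ ≤ N₂⁻¹ y
1≤N₂⁻¹ = lo≤inverse Superadd.N₂-increasing

0≤n₂⁻¹ : ∀ y → fromℚ 0ℚ ≤ n₂⁻¹ y
0≤n₂⁻¹ = lo≤inverse Superadd.n₂-increasing

0≤root : ∀ m y → fromℚ 0ℚ ≤ root (suc m) y
0≤root m = lo≤inverse (Superadd.^-increasing m)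

N₂-N₂⁻¹ : ∀ {y} → fromℚ 1ℚ ≤ y → N₂ (N₂⁻¹ y) ≈ y
N₂-N₂⁻¹ = inverse-correct Superadd.N₂-increasing Extension.N₂-ext

n₂-n₂⁻¹ : ∀ {y} → fromℚ 1ℚ ≤ y → n₂ (n₂⁻¹ y) ≈ y
n₂-n₂⁻¹ = inverse-correct Superadd.n₂-increasing Extension.n₂-ext

root-^ : ∀ m {y} → fromℚ 0ℚ ≤ y → root (suc m) y ^ suc m ≈ y
root-^ m {y} 0≤y = inverse-correct (Superadd.^-increasing m) (Extension.var Extension.⊛ suc m)
  (subst (λ c → fromℚ c ≤ y) (sym (ℚ.*-zeroˡ (0ℚ Polyℚ.^ m))) 0≤y)

Q₂ : ℝ → ℝ
Q₂ x = (x - fromℕ 1) * (fromℕ 2 * x + fromℚ ½ - √ (x - fromℚ (+ 3 ℚ./ 4))) + fromℕ 1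

-- ⌊ x ⌋ = m as a relation: locating a real number among the integers
-- is not decidable.
IsFloor : ℝ → ℤ → Set
IsFloor x m = fromℤ m ≤ x × x < fromℤ (ℤ.suc m)

{-# OPTIONS --safe #-}

-- Write s for the parameter with n = n₂ s.  From E (r - 1) = P q - 1 and
-- F (q - 1) = P r - 1 one gets C (q - 1) = (P - 1) (P + E), where
-- C = E F - P² ≥ 1 and E < P < F.  If C ≥ 2, then P is so large compared
-- with √q that q ≥ q₂ s would force n > n₂ s.  If C = 1, put a = P - E;
-- then E divides a² + 1, so P ≤ p₂ a and q ≤ q₂ a, and q ≥ q₂ s gives
-- first a ≥ s, then P ≥ p₂ s and r ≥ r₂ s, and hence n ≥ n₂ s.
-- The explicit bound compares s with t = (n / 4)^(1/10), where q₂ s and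
-- the right-hand side are polynomials in s and t.
--
-- On the Cauchy reals _≤_ is the negation of the reversed _<_, so it may
-- be proved by contradiction, although the order is not decidable.

module Submission where

open import Defs
open import Algebra.Bundles using (CommutativeRing; RawRing)
open import Algebra.Solver.Ring.AlmostCommutativeRing using (fromCommutativeRing; _-Raw-AlmostCommutative⟶_)
open import Algebra.Structures using (IsCommutativeRing)
import Algebra.Solver.Ring
open import Data.Fin.Base as Fin using (Fin; inject₁)
import Data.Fin.Properties as Fin
open import Data.Integer.Base as ℤ using (ℤ; +_)
import Data.Integer.Properties as ℤ
open import Data.List.Base using (List; []; _∷_; tabulate)
open import Data.Maybe.Base using (Maybe; just; nothing)
open import Data.Nat.Base as ℕ using (ℕ; zero; suc)
open import Data.Nat.Divisibility using (_∣_; divides; ∣m+n∣m⇒∣n; n∣m*n)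
open import Data.Nat.ListAction using (product)
import Data.Nat.Properties as ℕ
import Data.Nat.Solver
open import Data.Product.Base using (_×_; _,_; proj₁; proj₂; ∃)
open import Data.Rational.Base as ℚ using (ℚ; 0ℚ; 1ℚ; ½; ∣_∣)
import Data.Rational.Properties as ℚ
import Data.Rational.Solver
import Data.Rational.Unnormalised.Base as ℚᵘ
import Data.Rational.Unnormalised.Properties as ℚᵘ
open import Data.Sum.Base using (inj₁; inj₂)
open import Function.Bundles using (_⇔_; mk⇔; Equivalence)
open import Level using (0ℓ)
import Relation.Binary.Reasoning.Base.Triple
open import Relation.Binary.PropositionalEquality as ≡ using (_≡_; subst; subst₂; cong)
open import Relation.Binary.Structures using (IsEquivalence; IsPreorder)
open import Relation.Nullary using (¬_; yes; no)
open import Relation.Nullary.Decidable using (True; toWitness)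
open import Relation.Nullary.Negation using (contradiction)

open RationalLemmas hiding (*-pos; *-nonneg)
open ℝ using (seq; isCauchy)

-- For C = 1 and E = a² + 1 the two quotient equations give exactly P = `p₂ a`, q = `q₂ a`, r =
-- `r₂ a`, so `n₂` is the extremal family with a real parameter. Since `p₂ s` - 3/4 is a square, x =
-- `p₂ s` turns `N₂` into `n₂` and `Q₂` into `q₂`, and the square root disappears.
--
-- The explicit bound leaves little room. Write B(t) for its right-hand side. B(t) - `q₂ s` stays
-- bounded as s grows, while B' is of order 8s³, so t has to be bounded below with an error of
-- O(1/s³). Because `n₂ s` = `N₂ x` with x = s² + s + 1, this takes two stages: a fifth root in x,
-- which bounds t², and then a square root in s. Each stage guesses a rational function and verifies
-- it by raising to the power. The second guess is false for small s (at s = 0 it reads t ≥ 1),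
-- which is why s ≥ 7/10 is extracted from n ≥ 3 · 5 · 7.

module QS = Data.Rational.Solver.+-*-Solver

-- Integer arithmetic of the factorisation

module Arithmetic where

  open Data.Nat.Solver.+-*-Solver using (solve; _:=_; _:+_; _:*_; con)

  -- `tabulate` peels factors off the front, whereas q and r are the last two; two applications give
  -- n = P q r.
  product-tabulate-last : ∀ m (f : Fin (suc m) → ℕ) →
    product (tabulate f) ≡ product (tabulate (λ i → f (inject₁ i))) ℕ.* f (Fin.fromℕ m)
  product-tabulate-last zero    f = ℕ.*-comm (f Fin.zero) 1
  product-tabulate-last (suc m) f = ≡.trans
    (cong (f Fin.zero ℕ.*_) (product-tabulate-last m (λ i → f (Fin.suc i))))
    (≡.sym (ℕ.*-assoc (f Fin.zero) _ _))

  1≤product-tabulate : ∀ {m} (f : Fin m → ℕ) → (∀ i → 1 ℕ.≤ f i) → 1 ℕ.≤ product (tabulate f)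
  1≤product-tabulate {zero}  f 1≤f = ℕ.≤-refl
  1≤product-tabulate {suc m} f 1≤f =
    ℕ.*-mono-≤ (1≤f Fin.zero) (1≤product-tabulate (λ i → f (Fin.suc i)) (λ i → 1≤f (Fin.suc i)))

  -- Oddness raises the bounds 2, 4 and 6 that the ordering gives for a first factor, q and r to 3,
  -- 5 and 7.
  odd⇒2m<n : ∀ m {n} → ¬ (2 ∣ n) → 2 ℕ.* m ℕ.≤ n → 2 ℕ.* m ℕ.< n
  odd⇒2m<n m odd 2m≤n = ℕ.≤∧≢⇒< 2m≤n λ 2m≡n → odd (divides m (≡.trans (≡.sym 2m≡n) (ℕ.*-comm 2 m)))

  -- m (k + 1) - 1 = m k + (m - 1), so k divides m - 1.
  ∣m*suc[k]∸1 : ∀ {m k} → 1 ℕ.≤ m → k ∣ (m ℕ.* suc k ℕ.∸ 1) → ∃ λ e → m ≡ suc (e ℕ.* k)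
  ∣m*suc[k]∸1 {suc m} {k} _ k∣ =
    let divides e eq = ∣m+n∣m⇒∣n (subst (k ∣_) (rearrange m k) k∣) (n∣m*n (suc m))
    in e , cong suc eq
    where
    rearrange : ∀ m k → k ℕ.+ m ℕ.* suc k ≡ suc m ℕ.* k ℕ.+ m
    rearrange = solve 2 (λ m k → k :+ m :* (con 1 :+ k) :=
      (con 1 :+ m) :* k :+ m) ≡.refl

  -- P₁, q₁ and r₁ stand for P - 1, q - 1 and r - 1.  In the extremal case
  -- a = P - E and F = P + a + 1 + c.
  data Shape (P₁ q₁ r₁ : ℕ) : Set where
    extremal : ∀ E a c →
      suc P₁ ≡ E ℕ.+ a →
      E ℕ.* suc c ≡ suc (a ℕ.* a) →
      q₁ ≡ P₁ ℕ.* (suc P₁ ℕ.+ E) →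
      r₁ ≡ P₁ ℕ.* (suc P₁ ℕ.+ (suc P₁ ℕ.+ suc (a ℕ.+ c))) →
      Shape P₁ q₁ r₁
    dominated :
      2 ℕ.* q₁ ℕ.≤ P₁ ℕ.* (suc P₁ ℕ.+ P₁) →
      suc P₁ ℕ.* suc q₁ ℕ.+ suc P₁ ℕ.+ q₁ ℕ.≤ suc P₁ ℕ.* suc r₁ →
      Shape P₁ q₁ r₁

  -- The shape is extremal if E F - P² = 1 and dominated if E F - P² ≥ 2.
  module _ {P₁ q₁ r₁ : ℕ} (0<P₁ : 0 ℕ.< P₁) (0<q₁ : 0 ℕ.< q₁) (q₁<r₁ : q₁ ℕ.< r₁) where
    private
      P q r : ℕ
      P = suc P₁
      q = suc q₁
      r = suc r₁

      instance
        q₁≢0 : ℕ.NonZero q₁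
        q₁≢0 = ℕ.>-nonZero 0<q₁

    shape-of-quotients : ∀ {E F} → P ℕ.* q ≡ suc (E ℕ.* r₁) → P ℕ.* r ≡ suc (F ℕ.* q₁) → Shape P₁ q₁ r₁
    shape-of-quotients {E} {F} Pq≡ Pr≡ = by-C (ℕ.m≤n⇒∃[o]m+o≡n P²<EF)
      where
      E<P : E ℕ.< P
      E<P = ℕ.*-cancelʳ-< q E P (ℕ.≤-trans
        (ℕ.s≤s (ℕ.*-monoʳ-≤ E q₁<r₁)) (ℕ.≤-reflexive (≡.sym Pq≡)))

      0<E : 0 ℕ.< E
      0<E = ℕ.n≢0⇒n>0 λ E≡0 → ℕ.<-irrefl
        (≡.sym (≡.trans Pq≡ (cong (λ e → suc (e ℕ.* r₁)) E≡0)))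
        (ℕ.*-mono-≤ {2} {P} {1} {q} (ℕ.s≤s 0<P₁) (ℕ.s≤s ℕ.z≤n))

      instance
        E≢0 : ℕ.NonZero E
        E≢0 = ℕ.>-nonZero 0<E

      Er₁≡ : E ℕ.* r₁ ≡ P₁ ℕ.+ P ℕ.* q₁
      Er₁≡ = ≡.trans (≡.sym (ℕ.suc-injective Pq≡))
        (solve 2 (λ p q → q :+ p :* (con 1 :+ q) :=
          p :+ (con 1 :+ p) :* q) ≡.refl P₁ q₁)

      -- Multiplying P r = 1 + F q₁ by E and substituting E r₁ eliminates r. E F and P² stay on
      -- opposite sides because the sign of C is only read off from this identity.
      EFq₁≡ : E ℕ.* F ℕ.* q₁ ≡ P ℕ.* P ℕ.* q₁ ℕ.+ P₁ ℕ.* (P ℕ.+ E)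
      EFq₁≡ = ℕ.+-cancelʳ-≡ E _ _ (begin
        E ℕ.* F ℕ.* q₁ ℕ.+ E
          ≡⟨ solve 3 (λ e f q → e :* f :* q :+ e := e :* (con 1 :+ f :* q)) ≡.refl E F q₁ ⟩
        E ℕ.* suc (F ℕ.* q₁)                      ≡⟨ cong (E ℕ.*_) Pr≡ ⟨
        E ℕ.* (P ℕ.* r)
          ≡⟨ solve 3 (λ e p r → e :* (p :* (con 1 :+ r)) := p :* (e :* r) :+ e :* p) ≡.refl E P r₁ ⟩
        P ℕ.* (E ℕ.* r₁) ℕ.+ E ℕ.* P              ≡⟨ cong (λ z → P ℕ.* z ℕ.+ E ℕ.* P) Er₁≡ ⟩
        P ℕ.* (P₁ ℕ.+ P ℕ.* q₁) ℕ.+ E ℕ.* P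
          ≡⟨ solve 3 (λ e p q → let P = con 1 :+ p in P :* (p :+ P :* q) :+ e :* P :=
                                                       P :* P :* q :+ p :* (P :+ e) :+ e) ≡.refl E P₁ q₁ ⟩
        P ℕ.* P ℕ.* q₁ ℕ.+ P₁ ℕ.* (P ℕ.+ E) ℕ.+ E ∎)
        where open ≡.≡-Reasoning

      P²<EF : P ℕ.* P ℕ.< E ℕ.* F
      P²<EF = ℕ.*-cancelʳ-< q₁ _ _ (ℕ.<-≤-trans
        (ℕ.m<m+n (P ℕ.* P ℕ.* q₁) (ℕ.*-mono-≤ 0<P₁ (ℕ.s≤s ℕ.z≤n)))
        (ℕ.≤-reflexive (≡.sym EFq₁≡)))

      Cq₁≡ : ∀ {C} → E ℕ.* F ≡ P ℕ.* P ℕ.+ C → C ℕ.* q₁ ≡ P₁ ℕ.* (P ℕ.+ E)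
      Cq₁≡ {C} EF≡ = ℕ.+-cancelˡ-≡ (P ℕ.* P ℕ.* q₁) _ _ (≡.trans
        (≡.sym (ℕ.*-distribʳ-+ q₁ (P ℕ.* P) C)) (≡.trans (cong (ℕ._* q₁) (≡.sym EF≡)) EFq₁≡))

      P<F : P ℕ.< F
      P<F = ℕ.*-cancelˡ-< P P F (ℕ.<-≤-trans P²<EF (ℕ.*-monoˡ-≤ F (ℕ.<⇒≤ E<P)))

      -- Here b = F - P, and E F = P² + 1 reads E (b - a) = a² + 1.
      unit : ∀ {a b} → E ℕ.+ a ≡ P → P ℕ.+ b ≡ F → E ℕ.* F ≡ P ℕ.* P ℕ.+ 1 → Shape P₁ q₁ r₁
      unit {a} {b} E+a≡P P+b≡F EF≡ = split (ℕ.m≤n⇒∃[o]m+o≡n a<b)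
        where
        open ≡.≡-Reasoning
        Eb≡ : E ℕ.* b ≡ E ℕ.* a ℕ.+ suc (a ℕ.* a)
        Eb≡ = ℕ.+-cancelˡ-≡ (E ℕ.* (E ℕ.+ a)) _ _ (begin
          E ℕ.* (E ℕ.+ a) ℕ.+ E ℕ.* b   ≡⟨ ℕ.*-distribˡ-+ E (E ℕ.+ a) b ⟨
          E ℕ.* (E ℕ.+ a ℕ.+ b)         ≡⟨ cong (E ℕ.*_) (≡.trans (cong (ℕ._+ b) E+a≡P) P+b≡F) ⟩
          E ℕ.* F                       ≡⟨ EF≡ ⟩
          P ℕ.* P ℕ.+ 1                 ≡⟨ cong (λ z → z ℕ.* z ℕ.+ 1) E+a≡P ⟨
          (E ℕ.+ a) ℕ.* (E ℕ.+ a) ℕ.+ 1 ≡⟨ solve 2 (λ e a → (e :+ a) :* (e :+ a) :+ con 1 :=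
            e :* (e :+ a) :+ (e :* a :+ (con 1 :+ a :* a))) ≡.refl E a ⟩
          E ℕ.* (E ℕ.+ a) ℕ.+ (E ℕ.* a ℕ.+ suc (a ℕ.* a)) ∎)

        a<b : a ℕ.< b
        a<b = ℕ.*-cancelˡ-< E a b (ℕ.<-≤-trans (ℕ.m<m+n (E ℕ.* a) ℕ.z<s) (ℕ.≤-reflexive (≡.sym Eb≡)))

        q₁≡ : q₁ ≡ P₁ ℕ.* (P ℕ.+ E)
        q₁≡ = ≡.trans (≡.sym (ℕ.*-identityˡ q₁)) (Cq₁≡ EF≡)

        -- E r₁ = P₁ (1 + P² + P E), and 1 + P² = E F makes E a common factor.
        r₁≡ : r₁ ≡ P₁ ℕ.* (P ℕ.+ F)
        r₁≡ = ℕ.*-cancelˡ-≡ r₁ _ E (begin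
          E ℕ.* r₁                               ≡⟨ Er₁≡ ⟩
          P₁ ℕ.+ P ℕ.* q₁                        ≡⟨ cong (λ z → P₁ ℕ.+ P ℕ.* z) q₁≡ ⟩
          P₁ ℕ.+ P ℕ.* (P₁ ℕ.* (P ℕ.+ E))        ≡⟨ solve 3 (λ p P e → p :+ P :* (p :* (P :+ e)) :=
            p :* (e :* P) :+ p :* (P :* P :+ con 1)) ≡.refl P₁ P E ⟩
          P₁ ℕ.* (E ℕ.* P) ℕ.+ P₁ ℕ.* (P ℕ.* P ℕ.+ 1)
            ≡⟨ cong (λ z → P₁ ℕ.* (E ℕ.* P) ℕ.+ P₁ ℕ.* z) EF≡ ⟨
          P₁ ℕ.* (E ℕ.* P) ℕ.+ P₁ ℕ.* (E ℕ.* F)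
            ≡⟨ solve 4 (λ p P e f → p :* (e :* P) :+ p :* (e :* f) :=
            e :* (p :* (P :+ f))) ≡.refl P₁ P E F ⟩
          E ℕ.* (P₁ ℕ.* (P ℕ.+ F)) ∎)

        split : (∃ λ c → suc a ℕ.+ c ≡ b) → Shape P₁ q₁ r₁
        split (c , a+1+c≡b) = extremal E a c (≡.sym E+a≡P)
          (ℕ.+-cancelˡ-≡ (E ℕ.* a) _ _ (≡.trans (≡.sym (ℕ.*-distribˡ-+ E a (suc c)))
            (≡.trans (cong (E ℕ.*_) (≡.trans (ℕ.+-suc a c) a+1+c≡b)) Eb≡)))
          q₁≡
          (≡.trans r₁≡ (cong (λ z → P₁ ℕ.* (P ℕ.+ z)) (≡.sym (≡.trans (cong (P ℕ.+_) a+1+c≡b) P+b≡F))))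

      -- P r = P + r₁ + P₁ r₁, where r₁ ≥ q, and E ≤ P₁ gives P₁ r₁ ≥ E r₁ = P q - 1.
      Pr-large : P ℕ.* q ℕ.+ P ℕ.+ q₁ ℕ.≤ P ℕ.* r
      Pr-large = begin
        P ℕ.* q ℕ.+ P ℕ.+ q₁          ≡⟨ solve 2 (λ p q → let P = con 1 :+ p in
          P :* (con 1 :+ q) :+ P :+ q := P :+ (con 1 :+ q) :+ (p :+ P :* q)) ≡.refl P₁ q₁ ⟩
        P ℕ.+ q ℕ.+ (P₁ ℕ.+ P ℕ.* q₁) ≡⟨ cong (P ℕ.+ q ℕ.+_) Er₁≡ ⟨
        P ℕ.+ q ℕ.+ E ℕ.* r₁
          ≤⟨ ℕ.+-mono-≤ (ℕ.+-monoʳ-≤ P q₁<r₁) (ℕ.*-monoˡ-≤ r₁ (ℕ.s≤s⁻¹ E<P)) ⟩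
        P ℕ.+ r₁ ℕ.+ P₁ ℕ.* r₁        ≡⟨ solve 2 (λ p r → let P = con 1 :+ p in
          P :+ r :+ p :* r := P :* (con 1 :+ r)) ≡.refl P₁ r₁ ⟩
        P ℕ.* r ∎
        where open ℕ.≤-Reasoning

      by-C : (∃ λ c → suc (P ℕ.* P) ℕ.+ c ≡ E ℕ.* F) → Shape P₁ q₁ r₁
      by-C (zero  , eq) =
        let _ , E+a≡P = ℕ.m≤n⇒∃[o]m+o≡n (ℕ.<⇒≤ E<P)
            _ , P+b≡F = ℕ.m≤n⇒∃[o]m+o≡n (ℕ.<⇒≤ P<F)
        in unit E+a≡P P+b≡F
          (≡.trans (≡.sym eq) (≡.trans (ℕ.+-identityʳ _) (ℕ.+-comm 1 (P ℕ.* P))))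
      -- Here C = c + 2, and E ≤ P - 1 removes E from the bound on q.
      by-C (suc c , eq) = dominated
        (ℕ.≤-trans (ℕ.*-monoˡ-≤ q₁ {2} {suc (suc c)} (ℕ.s≤s (ℕ.s≤s ℕ.z≤n)))
          (ℕ.≤-trans (ℕ.≤-reflexive (Cq₁≡ (≡.trans (≡.sym eq) (≡.sym (ℕ.+-suc (P ℕ.* P) (suc c))))))
            (ℕ.*-monoʳ-≤ P₁ (ℕ.+-monoʳ-≤ P (ℕ.s≤s⁻¹ E<P)))))
        Pr-large

    shape : r₁ ∣ (P ℕ.* q ℕ.* r ℕ.∸ 1) → q₁ ∣ (P ℕ.* q ℕ.* r ℕ.∸ 1) → Shape P₁ q₁ r₁
    shape r₁∣ q₁∣ =
      let E , Pq≡ = ∣m*suc[k]∸1 (ℕ.s≤s ℕ.z≤n) r₁∣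
          F , Pr≡ = ∣m*suc[k]∸1 (ℕ.s≤s ℕ.z≤n) q₁∣′
      in shape-of-quotients {E} {F} Pq≡ Pr≡
      where
      q₁∣′ : q₁ ∣ (P ℕ.* r ℕ.* q ℕ.∸ 1)
      q₁∣′ = subst (λ z → q₁ ∣ (z ℕ.∸ 1))
        (solve 3 (λ p q r → p :* q :* r := p :* r :* q) ≡.refl P q r) q₁∣

  module _ {n : ℕ} (K : KorseltNumber n) where
    open KorseltNumber K

    n≡Pqr : n ≡ P ℕ.* q ℕ.* r
    n≡Pqr = ≡.trans n≡∏p (≡.trans (product-tabulate-last (2 ℕ.+ k) p)
      (cong (ℕ._* r) (product-tabulate-last (suc k) (λ i → p (inject₁ i)))))

    private
      3≤p₀ : 3 ℕ.≤ p Fin.zero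
      3≤p₀ = odd⇒2m<n 1 (p-odd Fin.zero) (1<p Fin.zero)

    3≤P : 3 ℕ.≤ P
    3≤P = ℕ.*-mono-≤ 3≤p₀
      (1≤product-tabulate {k} (λ i → p (inject₁ (inject₁ (Fin.suc i)))) (λ i → ℕ.<⇒≤ (1<p _)))

    q<r : q ℕ.< r
    q<r = p-mono _ _ (subst₂ ℕ._<_
      (≡.sym (≡.trans (Fin.toℕ-inject₁ (Fin.fromℕ (suc k))) (Fin.toℕ-fromℕ (suc k))))
      (≡.sym (Fin.toℕ-fromℕ (2 ℕ.+ k))) (ℕ.n<1+n (suc k)))

    5≤q : 5 ℕ.≤ q
    5≤q = odd⇒2m<n 2 (p-odd _) (ℕ.≤-trans (ℕ.s≤s 3≤p₀) (p-mono Fin.zero _ (ℕ.s≤s ℕ.z≤n)))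

    7≤r : 7 ℕ.≤ r
    7≤r = odd⇒2m<n 3 (p-odd _) (ℕ.≤-trans (ℕ.s≤s 5≤q) q<r)

open Arithmetic

-- The ring of real numbers

≡⇒≈ : ∀ {x y} → (∀ k → seq x k ≡ seq y k) → x ≈ y
≡⇒≈ {x} {y} eq = *≈* λ 0<ε → 0 , λ k _ →
  subst (ℚ._< _) (≡.sym (≡.trans (cong (λ z → ∣ z ℚ.- seq y k ∣) (eq k))
    (cong ∣_∣ (ℚ.+-inverseʳ (seq y k))))) 0<ε

≈⇒≤ : ∀ {x y} → x ≈ y → x ≤ y
≈⇒≤ {x} {y} x≈y = *≤* λ 0<ε →
  let N , close = _≈_.close x≈y 0<ε
  in N , λ k k≥ → dist⇒< (seq x k) (seq y k) (close k k≥)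

≤-antisym : ∀ {x y} → x ≤ y → y ≤ x → x ≈ y
≤-antisym {x} {y} x≤y y≤x = *≈* λ 0<ε →
  let M , x< = _≤_.upTo x≤y 0<ε
      N , y< = _≤_.upTo y≤x 0<ε
  in M ℕ.⊔ N , λ k k≥ → <⇒dist (seq x k) (seq y k)
    (x< k (ℕ.m⊔n≤o⇒m≤o M N k≥)) (y< k (ℕ.m⊔n≤o⇒n≤o M N k≥))

≈-sym : ∀ {x y} → x ≈ y → y ≈ x
≈-sym {x} {y} x≈y = *≈* λ 0<ε →
  let N , close = _≈_.close x≈y 0<ε
  in N , λ k k≥ → subst (ℚ._< _) (dist-sym (seq x k) (seq y k)) (close k k≥)

≤-trans : ∀ {x y z} → x ≤ y → y ≤ z → x ≤ z
≤-trans {x} {y} {z} x≤y y≤z = *≤* λ {ε} 0<ε →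
  let M , x< = _≤_.upTo x≤y (half-pos 0<ε)
      N , y< = _≤_.upTo y≤z (half-pos 0<ε)
  in M ℕ.⊔ N , λ k k≥ → ℚ.<-trans (x< k (ℕ.m⊔n≤o⇒m≤o M N k≥))
    (subst (seq y k ℚ.+ ½ ℚ.* ε ℚ.<_)
      (≡.trans (ℚ.+-assoc (seq z k) (½ ℚ.* ε) (½ ℚ.* ε)) (cong (seq z k ℚ.+_) (half+half ε)))
      (ℚ.+-monoˡ-< (½ ℚ.* ε) (y< k (ℕ.m⊔n≤o⇒n≤o M N k≥))))

≈-trans : ∀ {x y z} → x ≈ y → y ≈ z → x ≈ z
≈-trans x≈y y≈z = ≤-antisym (≤-trans (≈⇒≤ x≈y) (≈⇒≤ y≈z))
  (≤-trans (≈⇒≤ (≈-sym y≈z)) (≈⇒≤ (≈-sym x≈y)))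

≤-refl : ∀ {x} → x ≤ x
≤-refl = ≈⇒≤ ≈-refl

≈-isEquivalence : IsEquivalence _≈_
≈-isEquivalence = record { refl = ≈-refl ; sym = ≈-sym ; trans = ≈-trans }

+-*-isCommutativeRing : IsCommutativeRing _≈_ _+_ _*_ -_ (fromℚ 0ℚ) (fromℚ 1ℚ)
+-*-isCommutativeRing = record
  { isRing = record
    { +-isAbelianGroup = record
      { isGroup = record
        { isMonoid = record
          { isSemigroup = record
            { isMagma = record { isEquivalence = ≈-isEquivalence ; ∙-cong = +-cong }
            ; assoc = λ x y z → ≡⇒≈ λ k → ℚ.+-assoc (seq x k) (seq y k) (seq z k) }
          ; identity = (λ x → ≡⇒≈ λ k → ℚ.+-identityˡ (seq x k))
                     , (λ x → ≡⇒≈ λ k → ℚ.+-identityʳ (seq x k)) }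
        ; inverse = (λ x → ≡⇒≈ λ k → ℚ.+-inverseˡ (seq x k))
                  , (λ x → ≡⇒≈ λ k → ℚ.+-inverseʳ (seq x k))
        ; ⁻¹-cong = -‿cong }
      ; comm = λ x y → ≡⇒≈ λ k → ℚ.+-comm (seq x k) (seq y k) }
    ; *-cong = *-cong
    ; *-assoc = λ x y z → ≡⇒≈ λ k → ℚ.*-assoc (seq x k) (seq y k) (seq z k)
    ; *-identity = (λ x → ≡⇒≈ λ k → ℚ.*-identityˡ (seq x k))
                 , (λ x → ≡⇒≈ λ k → ℚ.*-identityʳ (seq x k))
    ; distrib = (λ x y z → ≡⇒≈ λ k → ℚ.*-distribˡ-+ (seq x k) (seq y k) (seq z k))
              , (λ x y z → ≡⇒≈ λ k → ℚ.*-distribʳ-+ (seq x k) (seq y k) (seq z k)) }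
  ; *-comm = λ x y → ≡⇒≈ λ k → ℚ.*-comm (seq x k) (seq y k) }

+-*-commutativeRing : CommutativeRing 0ℓ 0ℓ
+-*-commutativeRing = record { isCommutativeRing = +-*-isCommutativeRing }

fromℚ-≟ : ∀ a b → Maybe (fromℚ a ≈ fromℚ b)
fromℚ-≟ a b with a ℚ.≟ b
... | yes a≡b = just (≡⇒≈ λ _ → a≡b)
... | no  _   = nothing

open CommutativeRing +-*-commutativeRing using (+-comm; *-comm)

fromℚ-morphism : ℚ.+-*-rawRing -Raw-AlmostCommutative⟶ fromCommutativeRing +-*-commutativeRing
fromℚ-morphism = record
  { ⟦_⟧ = fromℚ
  ; +-homo = λ _ _ → ≡⇒≈ λ _ → ≡.refl
  ; *-homo = λ _ _ → ≡⇒≈ λ _ → ≡.refl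
  ; -‿homo = λ _ → ≡⇒≈ λ _ → ≡.refl
  ; 0-homo = ≈-refl
  ; 1-homo = ≈-refl }

module ℝ-Solver = Algebra.Solver.Ring ℚ.+-*-rawRing
  (fromCommutativeRing +-*-commutativeRing) fromℚ-morphism fromℚ-≟
open ℝ-Solver using (solve; _:=_; _:+_; _:*_; _:-_; :-_; con; Polynomial)

-- Order on the real numbers

<⇒≤ : ∀ {x y} → x < y → x ≤ y
<⇒≤ {x} (*<* (ε , 0<ε , N , x+ε≤)) = *≤* λ 0<δ → N , λ k k≥ →
  ℚ.<-trans (ℚ.<-≤-trans (x<x+ε (seq x k) 0<ε) (x+ε≤ k k≥)) (x<x+ε _ 0<δ)

<⇒≱ : ∀ {x y} → x < y → ¬ (y ≤ x)
<⇒≱ (*<* (ε , 0<ε , M , x+ε≤)) y≤x =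
  let N , y< = _≤_.upTo y≤x 0<ε
      k = M ℕ.⊔ N
  in ℚ.<-irrefl ≡.refl (ℚ.<-≤-trans (y< k (ℕ.m≤n⊔m M N)) (x+ε≤ k (ℕ.m≤m⊔n M N)))

<-≤-trans : ∀ {x y z} → x < y → y ≤ z → x < z
<-≤-trans {x} {y} {z} (*<* (ε , 0<ε , M , x+ε≤)) y≤z =
  let N , y< = _≤_.upTo y≤z (half-pos 0<ε)
  in *<* (½ ℚ.* ε , half-pos 0<ε , M ℕ.⊔ N , λ k k≥ →
    ℚ.<⇒≤ (ℚ.≤-<-trans
      (ℚ.≤-trans
        (ℚ.≤-reflexive (QS.solve 2 (λ x e → x QS.:+ QS.con ½ QS.:* e QS.:=
          x QS.:+ e QS.:+ QS.:- (QS.con ½ QS.:* e)) ≡.refl (seq x k) ε))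
        (ℚ.+-monoˡ-≤ (ℚ.- (½ ℚ.* ε)) (x+ε≤ k (ℕ.m⊔n≤o⇒m≤o M N k≥))))
      (subst (seq y k ℚ.- ½ ℚ.* ε ℚ.<_)
        (QS.solve 2 (λ z h → z QS.:+ h QS.:- h QS.:= z) ≡.refl (seq z k) (½ ℚ.* ε))
        (ℚ.+-monoˡ-< (ℚ.- (½ ℚ.* ε)) (y< k (ℕ.m⊔n≤o⇒n≤o M N k≥))))))

≤-<-trans : ∀ {x y z} → x ≤ y → y < z → x < z
≤-<-trans {x} {y} {z} x≤y (*<* (ε , 0<ε , M , y+ε≤)) =
  let N , x< = _≤_.upTo x≤y (half-pos 0<ε)
  in *<* (½ ℚ.* ε , half-pos 0<ε , M ℕ.⊔ N , λ k k≥ →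
    ℚ.≤-trans (ℚ.<⇒≤ (subst (seq x k ℚ.+ ½ ℚ.* ε ℚ.<_)
        (≡.trans (ℚ.+-assoc (seq y k) (½ ℚ.* ε) (½ ℚ.* ε)) (cong (seq y k ℚ.+_) (half+half ε)))
        (ℚ.+-monoˡ-< (½ ℚ.* ε) (x< k (ℕ.m⊔n≤o⇒n≤o M N k≥)))))
      (y+ε≤ k (ℕ.m⊔n≤o⇒m≤o M N k≥)))

-- Let δ = ε / 5.  From some index m on the terms are within δ of the
-- m-th one; comparing x_m with y_m + 3δ then decides between
-- x < y + ε and y < x.
≮⇒≥ : ∀ {x y} → ¬ (y < x) → x ≤ y
≮⇒≥ {x} {y} y≮x = *≤* λ 0<ε →
  let δ , 0<δ , 5δ≡ε = scale {5ℚ} (ℚ.positive⁻¹ 5ℚ) 0<ε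
      M , close-x = isCauchy x 0<δ
      N , close-y = isCauchy y 0<δ
      m = M ℕ.⊔ N
  in m , subst (λ ε → ∀ k → m ℕ.≤ k → seq x k ℚ.< seq y k ℚ.+ ε) 5δ≡ε
    (below (seq x m) (seq y m) 0<δ
      (λ k k≥ → close-x k m (ℕ.m⊔n≤o⇒m≤o M N k≥) (ℕ.m≤m⊔n M N))
      (λ k k≥ → close-y k m (ℕ.m⊔n≤o⇒n≤o M N k≥) (ℕ.m≤n⊔m M N)))
  where
  5ℚ 3ℚ : ℚ
  5ℚ = + 5 ℚ./ 1
  3ℚ = + 3 ℚ./ 1

  below : ∀ a b {δ m} → 0ℚ ℚ.< δ →
    (∀ k → m ℕ.≤ k → ∣ seq x k ℚ.- a ∣ ℚ.< δ) →
    (∀ k → m ℕ.≤ k → ∣ seq y k ℚ.- b ∣ ℚ.< δ) →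
    ∀ k → m ℕ.≤ k → seq x k ℚ.< seq y k ℚ.+ 5ℚ ℚ.* δ
  below a b {δ} {m} 0<δ x~ y~ with a ℚ.<? b ℚ.+ 3ℚ ℚ.* δ
  ... | yes a< = λ k k≥ → ℚ.<-trans (dist⇒< (seq x k) a (x~ k k≥))
    (ℚ.<-trans (ℚ.+-monoˡ-< δ a<)
      (subst (b ℚ.+ 3ℚ ℚ.* δ ℚ.+ δ ℚ.<_)
        (QS.solve 2 (λ y d → (y QS.:+ d) QS.:+ QS.con 3ℚ QS.:* d QS.:+ d QS.:=
          y QS.:+ QS.con 5ℚ QS.:* d) ≡.refl (seq y k) δ)
        (ℚ.+-monoˡ-< δ (ℚ.+-monoˡ-< (3ℚ ℚ.* δ)
          (dist⇒< b (seq y k) (subst (ℚ._< δ) (dist-sym (seq y k) b) (y~ k k≥)))))))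
  ... | no a≮ = contradiction (*<* (δ , 0<δ , m , apart)) y≮x
    where
    apart : ∀ k → m ℕ.≤ k → seq y k ℚ.+ δ ℚ.≤ seq x k
    apart k k≥ = ℚ.<⇒≤ (ℚ.<-trans
      (ℚ.+-monoˡ-< δ (dist⇒< (seq y k) b (y~ k k≥)))
      (ℚ.≤-<-trans
        (subst (ℚ._≤ a ℚ.- δ)
          (QS.solve 2 (λ b d → b QS.:+ QS.con 3ℚ QS.:* d QS.:- d QS.:= b QS.:+ d QS.:+ d) ≡.refl b δ)
          (ℚ.+-monoˡ-≤ (ℚ.- δ) (ℚ.≮⇒≥ a≮)))
        (subst (a ℚ.- δ ℚ.<_) (QS.solve 2 (λ x d → x QS.:+ d QS.:- d QS.:= x) ≡.refl (seq x k) δ)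
          (ℚ.+-monoˡ-< (ℚ.- δ)
            (dist⇒< a (seq x k) (subst (ℚ._< δ) (dist-sym (seq x k) a) (x~ k k≥)))))))

0ℝ 1ℝ : ℝ
0ℝ = fromℚ 0ℚ
1ℝ = fromℚ 1ℚ

-- Assuming b < a, the second branch refutes y < x; this yields x ≤ y, and the first branch then
-- refutes b < a.
≤-by-cases : ∀ x y {a b} → (x ≤ y → a ≤ b) → (y < x → a ≤ b) → a ≤ b
≤-by-cases x y f g = ≮⇒≥ λ b<a →
  <⇒≱ b<a (f (≮⇒≥ λ y<x → <⇒≱ b<a (g y<x)))

<-trans : ∀ {x y z} → x < y → y < z → x < z
<-trans x<y y<z = <-≤-trans x<y (<⇒≤ y<z)

≤-isPreorder : IsPreorder _≈_ _≤_
≤-isPreorder = record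
  { isEquivalence = ≈-isEquivalence ; reflexive = ≈⇒≤ ; trans = ≤-trans }

module ≤-Reasoning = Relation.Binary.Reasoning.Base.Triple
  ≤-isPreorder
  (λ x<y y<x → <⇒≱ x<y (<⇒≤ y<x))
  <-trans
  ((λ y≈z x<y → <-≤-trans x<y (≈⇒≤ y≈z)) , (λ y≈z y<x → ≤-<-trans (≈⇒≤ (≈-sym y≈z)) y<x))
  <⇒≤ <-≤-trans ≤-<-trans

≤-respˡ : ∀ {x y z} → x ≈ y → x ≤ z → y ≤ z
≤-respˡ x≈y x≤z = ≤-trans (≈⇒≤ (≈-sym x≈y)) x≤z

≤-respʳ : ∀ {x y z} → x ≈ y → z ≤ x → z ≤ y
≤-respʳ x≈y z≤x = ≤-trans z≤x (≈⇒≤ x≈y)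

<-respˡ : ∀ {x y z} → x ≈ y → x < z → y < z
<-respˡ x≈y x<z = ≤-<-trans (≈⇒≤ (≈-sym x≈y)) x<z

<-respʳ : ∀ {x y z} → x ≈ y → z < x → z < y
<-respʳ x≈y z<x = <-≤-trans z<x (≈⇒≤ x≈y)

+-monoˡ-< : ∀ {x y} z → x < y → x + z < y + z
+-monoˡ-< {x} {y} z (*<* (ε , 0<ε , N , x+ε≤)) = *<* (ε , 0<ε , N , λ k k≥ →
  subst (ℚ._≤ seq y k ℚ.+ seq z k)
    (QS.solve 3 (λ x z e → x QS.:+ e QS.:+ z QS.:= x QS.:+ z QS.:+ e) ≡.refl (seq x k) (seq z k) ε)
    (ℚ.+-monoˡ-≤ (seq z k) (x+ε≤ k k≥)))

+-monoˡ-≤ : ∀ {x y} z → x ≤ y → x + z ≤ y + z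
+-monoˡ-≤ {x} {y} z x≤y = ≮⇒≥ λ y+z<x+z → <⇒≱
  (<-respˡ (cancel y) (<-respʳ (cancel x) (+-monoˡ-< (- z) y+z<x+z))) x≤y
  where
  cancel : ∀ x → x + z + (- z) ≈ x
  cancel x = solve 2 (λ x z → x :+ z :- z := x) ≈-refl x z

+-mono-≤ : ∀ {x y u v} → x ≤ y → u ≤ v → x + u ≤ y + v
+-mono-≤ {x} {y} {u} {v} x≤y u≤v = ≤-trans (+-monoˡ-≤ u x≤y)
  (≤-respˡ (+-comm u y) (≤-respʳ (+-comm v y) (+-monoˡ-≤ y u≤v)))

+-mono-<-≤ : ∀ {x y u v} → x < y → u ≤ v → x + u < y + v
+-mono-<-≤ {u = u} x<y u≤v = <-≤-trans (+-monoˡ-< u x<y) (+-mono-≤ ≤-refl u≤v)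

0≤y-x : ∀ {x y} → x ≤ y → 0ℝ ≤ y - x
0≤y-x {x} x≤y = ≤-respˡ (solve 1 (λ x → x :- x := con 0ℚ) ≈-refl x) (+-monoˡ-≤ (- x) x≤y)

0<y-x : ∀ {x y} → x < y → 0ℝ < y - x
0<y-x {x} x<y = <-respˡ (solve 1 (λ x → x :- x := con 0ℚ) ≈-refl x) (+-monoˡ-< (- x) x<y)

-- The pattern of most polynomial inequalities below: the slack e is written in a visibly
-- nonnegative form, and the ring solver checks the identity.
≤-by : ∀ {x y e} → 0ℝ ≤ e → x + e ≈ y → x ≤ y
≤-by {x} 0≤e x+e≈y = ≤-respʳ x+e≈y
  (≤-respˡ (solve 1 (λ x → x :+ con 0ℚ := x) ≈-refl x) (+-mono-≤ (≤-refl {x}) 0≤e))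

<-by : ∀ {x y e} → 0ℝ < e → x + e ≈ y → x < y
<-by {x} {e = e} 0<e x+e≈y = <-respʳ (≈-trans (+-comm e x) x+e≈y)
  (<-respˡ (solve 1 (λ x → con 0ℚ :+ x := x) ≈-refl x) (+-monoˡ-< x 0<e))

*-pos : ∀ {x y} → 0ℝ < x → 0ℝ < y → 0ℝ < x * y
*-pos {x} {y} (*<* (ε , 0<ε , M , ε≤x)) (*<* (δ , 0<δ , N , δ≤y)) =
  *<* (ε ℚ.* δ , RationalLemmas.*-pos 0<ε 0<δ , M ℕ.⊔ N , λ k k≥ →
    subst (ℚ._≤ seq x k ℚ.* seq y k) (≡.sym (ℚ.+-identityˡ (ε ℚ.* δ)))
      (let ε≤ = subst (ℚ._≤ seq x k) (ℚ.+-identityˡ ε) (ε≤x k (ℕ.m⊔n≤o⇒m≤o M N k≥))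
           δ≤ = subst (ℚ._≤ seq y k) (ℚ.+-identityˡ δ) (δ≤y k (ℕ.m⊔n≤o⇒n≤o M N k≥))
       in *-mono-nonneg (ℚ.≤-trans (ℚ.<⇒≤ 0<ε) ε≤) (ℚ.<⇒≤ 0<δ) ε≤ δ≤))

-- Compares x * y with the product of the positive parts of the terms.
*-nonneg : ∀ {x y} → 0ℝ ≤ x → 0ℝ ≤ y → 0ℝ ≤ x * y
*-nonneg {x} {y} 0≤x 0≤y = *≤* λ {ε} 0<ε →
  let A , 0<A , K , x≤A = tail-bounded x
      D , 0<D , L , y≤D = tail-bounded y
      δ , 0<δ , close-* = dist-* 0<A 0<D 0<ε
      M , x>-δ          = _≤_.upTo 0≤x 0<δ
      N , y>-δ          = _≤_.upTo 0≤y 0<δ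
  in (K ℕ.⊔ L) ℕ.⊔ (M ℕ.⊔ N) , λ k k≥ →
    let k≥KL = ℕ.m⊔n≤o⇒m≤o (K ℕ.⊔ L) _ k≥
        k≥MN = ℕ.m⊔n≤o⇒n≤o (K ℕ.⊔ L) _ k≥
        a = seq x k
        c = seq y k
    in ℚ.≤-<-trans (RationalLemmas.*-nonneg (ℚ.p≤q⊔p a 0ℚ) (ℚ.p≤q⊔p c 0ℚ))
      (dist⇒< ((a ℚ.⊔ 0ℚ) ℚ.* (c ℚ.⊔ 0ℚ)) (a ℚ.* c)
        (subst (ℚ._< ε) (dist-sym (a ℚ.* c) _)
          (close-* a (a ℚ.⊔ 0ℚ) c (c ℚ.⊔ 0ℚ) (x≤A k (ℕ.m⊔n≤o⇒m≤o K L k≥KL))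
            (ℚ.≤-trans (∣c⊔0∣≤∣c∣ c) (y≤D k (ℕ.m⊔n≤o⇒n≤o K L k≥KL)))
            (near a 0<δ (x>-δ k (ℕ.m⊔n≤o⇒m≤o M N k≥MN)))
            (near c 0<δ (y>-δ k (ℕ.m⊔n≤o⇒n≤o M N k≥MN))))))
  where
  ∣c⊔0∣≤∣c∣ : ∀ c → ∣ c ℚ.⊔ 0ℚ ∣ ℚ.≤ ∣ c ∣
  ∣c⊔0∣≤∣c∣ c = subst (ℚ._≤ ∣ c ∣) (≡.sym (ℚ.0≤p⇒∣p∣≡p (ℚ.p≤q⊔p c 0ℚ)))
    (ℚ.⊔-lub (x≤∣x∣ c) (ℚ.0≤∣p∣ c))

  near : ∀ a {δ} → 0ℚ ℚ.< δ → 0ℚ ℚ.< a ℚ.+ δ → ∣ a ℚ.- (a ℚ.⊔ 0ℚ) ∣ ℚ.< δ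
  near a {δ} 0<δ 0<a+δ = <⇒dist a (a ℚ.⊔ 0ℚ)
    (ℚ.≤-<-trans (ℚ.p≤p⊔q a 0ℚ) (x<x+ε (a ℚ.⊔ 0ℚ) 0<δ))
    (⊔-lub-< (x<x+ε a 0<δ) 0<a+δ)
    where
    ⊔-lub-< : ∀ {b} → a ℚ.< b → 0ℚ ℚ.< b → a ℚ.⊔ 0ℚ ℚ.< b
    ⊔-lub-< a<b 0<b with ℚ.⊔-sel a 0ℚ
    ... | inj₁ eq = subst (ℚ._< _) (≡.sym eq) a<b
    ... | inj₂ eq = subst (ℚ._< _) (≡.sym eq) 0<b

+-nonneg : ∀ {x y} → 0ℝ ≤ x → 0ℝ ≤ y → 0ℝ ≤ x + y
+-nonneg 0≤x 0≤y = ≤-respˡ (solve 0 (con 0ℚ :+ con 0ℚ := con 0ℚ) ≈-refl) (+-mono-≤ 0≤x 0≤y)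

+-pos-nonneg : ∀ {x y} → 0ℝ < x → 0ℝ ≤ y → 0ℝ < x + y
+-pos-nonneg 0<x 0≤y = <-respˡ (solve 0 (con 0ℚ :+ con 0ℚ := con 0ℚ) ≈-refl) (+-mono-<-≤ 0<x 0≤y)

*-mono-≤ : ∀ {a b c d} → 0ℝ ≤ a → a ≤ b → 0ℝ ≤ c → c ≤ d → a * c ≤ b * d
*-mono-≤ {a} {b} {c} {d} 0≤a a≤b 0≤c c≤d = ≤-by
  (+-nonneg (*-nonneg (0≤y-x a≤b) (≤-trans 0≤c c≤d)) (*-nonneg 0≤a (0≤y-x c≤d)))
  (solve 4 (λ a b c d → a :* c :+ ((b :- a) :* d :+ a :* (d :- c)) := b :* d) ≈-refl a b c d)

*-mono-<-≤ : ∀ {a b c d} → 0ℝ ≤ a → a < b → 0ℝ ≤ c → c ≤ d → 0ℝ < d → a * c < b * d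
*-mono-<-≤ {a} {b} {c} {d} 0≤a a<b 0≤c c≤d 0<d = <-by
  (+-pos-nonneg (*-pos (0<y-x a<b) 0<d) (*-nonneg 0≤a (0≤y-x c≤d)))
  (solve 4 (λ a b c d → a :* c :+ ((b :- a) :* d :+ a :* (d :- c)) := b :* d) ≈-refl a b c d)

*-cancelʳ-≤ : ∀ {a b c} → 0ℝ < c → a * c ≤ b * c → a ≤ b
*-cancelʳ-≤ {a} {b} {c} 0<c ac≤bc = ≮⇒≥ λ b<a → <⇒≱ (<-by (*-pos (0<y-x b<a) 0<c)
  (solve 3 (λ a b c → b :* c :+ (a :- b) :* c := a :* c) ≈-refl a b c)) ac≤bc

*-cancelʳ-≈ : ∀ {a b c} → 0ℝ < c → a * c ≈ b * c → a ≈ b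
*-cancelʳ-≈ 0<c ac≈bc = ≤-antisym (*-cancelʳ-≤ 0<c (≈⇒≤ ac≈bc)) (*-cancelʳ-≤ 0<c (≈⇒≤ (≈-sym ac≈bc)))

-- Embedding of rationals, integers and naturals

fromℚ-mono-≤ : ∀ {a b} → a ℚ.≤ b → fromℚ a ≤ fromℚ b
fromℚ-mono-≤ {b = b} a≤b = *≤* λ 0<ε → 0 , λ _ _ → ℚ.≤-<-trans a≤b (x<x+ε b 0<ε)

fromℚ-mono-< : ∀ {a b} → a ℚ.< b → fromℚ a < fromℚ b
fromℚ-mono-< {a} {b} a<b = *<* (b ℚ.- a ,
  subst (ℚ._< b ℚ.- a) (ℚ.+-inverseʳ a) (ℚ.+-monoˡ-< (ℚ.- a) a<b) , 0 , λ _ _ →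
  ℚ.≤-reflexive (QS.solve 2 (λ a b → a QS.:+ (b QS.:- a) QS.:= b) ≡.refl a b))

0≤fromℚ : ∀ a {0≤a : True (0ℚ ℚ.≤? a)} → 0ℝ ≤ fromℚ a
0≤fromℚ a {0≤a} = fromℚ-mono-≤ (toWitness 0≤a)

0<fromℚ : ∀ a {0<a : True (0ℚ ℚ.<? a)} → 0ℝ < fromℚ a
0<fromℚ a {0<a} = fromℚ-mono-< (toWitness 0<a)

/1-mono-≤ : ∀ {i j} → i ℤ.≤ j → i ℚ./ 1 ℚ.≤ j ℚ./ 1
/1-mono-≤ {i} {j} i≤j = ℚ.toℚᵘ-cancel-≤
  (ℚᵘ.≤-respˡ-≃ (ℚᵘ.≃-sym (ℚ.toℚᵘ-fromℚᵘ (ℚᵘ.mkℚᵘ i 0)))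
    (ℚᵘ.≤-respʳ-≃ (ℚᵘ.≃-sym (ℚ.toℚᵘ-fromℚᵘ (ℚᵘ.mkℚᵘ j 0)))
      (ℚᵘ.*≤* (ℤ.*-monoʳ-≤-nonNeg (+ 1) i≤j))))

/1-mono-< : ∀ {i j} → i ℤ.< j → i ℚ./ 1 ℚ.< j ℚ./ 1
/1-mono-< {i} {j} i<j = ℚ.toℚᵘ-cancel-<
  (ℚᵘ.<-respˡ-≃ (ℚᵘ.≃-sym (ℚ.toℚᵘ-fromℚᵘ (ℚᵘ.mkℚᵘ i 0)))
    (ℚᵘ.<-respʳ-≃ (ℚᵘ.≃-sym (ℚ.toℚᵘ-fromℚᵘ (ℚᵘ.mkℚᵘ j 0)))
      (ℚᵘ.*<* (ℤ.*-monoʳ-<-pos (+ 1) i<j))))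

fromℕ-mono-≤ : ∀ {m n} → m ℕ.≤ n → fromℕ m ≤ fromℕ n
fromℕ-mono-≤ m≤n = fromℚ-mono-≤ (/1-mono-≤ (ℤ.+≤+ m≤n))

fromℕ-mono-< : ∀ {m n} → m ℕ.< n → fromℕ m < fromℕ n
fromℕ-mono-< m<n = fromℚ-mono-< (/1-mono-< (ℤ.+<+ m<n))

fromℕ-nonneg : ∀ n → 0ℝ ≤ fromℕ n
fromℕ-nonneg n = fromℕ-mono-≤ {0} {n} ℕ.z≤n

+-/ : ∀ m n → + (m ℕ.+ n) ℚ./ 1 ≡ + m ℚ./ 1 ℚ.+ + n ℚ./ 1
+-/ m n = ℚ.toℚᵘ-injective (ℚᵘ.≃-trans
  (ℚ.toℚᵘ-fromℚᵘ (ℚᵘ.mkℚᵘ (+ (m ℕ.+ n)) 0))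
  (ℚᵘ.≃-sym (ℚᵘ.≃-trans (ℚ.toℚᵘ-homo-+ (+ m ℚ./ 1) (+ n ℚ./ 1))
    (ℚᵘ.≃-trans (ℚᵘ.+-cong (ℚ.toℚᵘ-fromℚᵘ (ℚᵘ.mkℚᵘ (+ m) 0)) (ℚ.toℚᵘ-fromℚᵘ (ℚᵘ.mkℚᵘ (+ n) 0)))
      (ℚᵘ.*≡* (cong (ℤ._* + 1) (≡.cong₂ ℤ._+_ (ℤ.*-identityʳ (+ m)) (ℤ.*-identityʳ (+ n)))))))))

*-/ : ∀ m n d .{{_ : ℕ.NonZero d}} → + (m ℕ.* n) ℚ./ d ≡ + m ℚ./ 1 ℚ.* (+ n ℚ./ d)
*-/ m n (suc d) = ℚ.toℚᵘ-injective (ℚᵘ.≃-trans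
  (ℚ.toℚᵘ-fromℚᵘ (ℚᵘ.mkℚᵘ (+ (m ℕ.* n)) d))
  (ℚᵘ.≃-sym (ℚᵘ.≃-trans (ℚ.toℚᵘ-homo-* (+ m ℚ./ 1) (+ n ℚ./ suc d))
    (ℚᵘ.≃-trans (ℚᵘ.*-cong (ℚ.toℚᵘ-fromℚᵘ (ℚᵘ.mkℚᵘ (+ m) 0)) (ℚ.toℚᵘ-fromℚᵘ (ℚᵘ.mkℚᵘ (+ n) d)))
      (ℚᵘ.*≡* (≡.cong₂ ℤ._*_ (≡.sym (ℤ.pos-* m n)) (≡.sym (cong (λ z → + suc z) (ℕ.+-identityʳ d)))))))))

fromℕ-+ : ∀ m n → fromℕ (m ℕ.+ n) ≈ fromℕ m + fromℕ n
fromℕ-+ m n = ≡⇒≈ λ _ → +-/ m n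

fromℕ-* : ∀ m n → fromℕ (m ℕ.* n) ≈ fromℕ m * fromℕ n
fromℕ-* m n = ≡⇒≈ λ _ → *-/ m n 1

-- Polynomials in a real variable

-- Natural coefficients make nonnegativity and monotonicity on [0, ∞) automatic for every list.
horner : List ℕ → ℝ → ℝ
horner []       x = 0ℝ
horner (c ∷ cs) x = fromℕ c + x * horner cs x

horner-nonneg : ∀ cs {x} → 0ℝ ≤ x → 0ℝ ≤ horner cs x
horner-nonneg []       0≤x = ≤-refl
horner-nonneg (c ∷ cs) 0≤x = +-nonneg (fromℕ-nonneg c) (*-nonneg 0≤x (horner-nonneg cs 0≤x))

horner-pos : ∀ c cs {x} → 0ℝ ≤ x → 0ℝ < horner (suc c ∷ cs) x
horner-pos c cs 0≤x = +-pos-nonneg (fromℕ-mono-< {0} {suc c} ℕ.z<s) (*-nonneg 0≤x (horner-nonneg cs 0≤x))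

horner-mono-≤ : ∀ cs {x y} → 0ℝ ≤ x → x ≤ y → horner cs x ≤ horner cs y
horner-mono-≤ []       0≤x x≤y = ≤-refl
horner-mono-≤ (c ∷ cs) 0≤x x≤y = +-mono-≤ (≤-refl {fromℕ c})
  (*-mono-≤ 0≤x x≤y (horner-nonneg cs 0≤x) (horner-mono-≤ cs 0≤x x≤y))

horner-mono-< : ∀ c d cs {x y} → 0ℝ ≤ x → x < y →
  horner (c ∷ suc d ∷ cs) x < horner (c ∷ suc d ∷ cs) y
horner-mono-< c d cs {x} {y} 0≤x x<y = <-respˡ (+-comm _ _) (<-respʳ (+-comm _ _)
  (+-monoˡ-< (fromℕ c) (*-mono-<-≤ 0≤x x<y (horner-nonneg (suc d ∷ cs) 0≤x)
    (horner-mono-≤ (suc d ∷ cs) 0≤x (<⇒≤ x<y))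
    (horner-pos d cs (≤-trans 0≤x (<⇒≤ x<y))))))

-- `Polynomials` instantiated at solver syntax evaluates definitionally to `N₂`, `q₂` and the rest,
-- so goals about them go to the solver directly.
syntaxRing : ℕ → RawRing 0ℓ 0ℓ
syntaxRing m = record
  { Carrier = Polynomial m ; _≈_ = _≡_ ; _+_ = _:+_ ; _*_ = _:*_ ; -_ = :-_
  ; 0# = con 0ℚ ; 1# = con 1ℚ }

module Syntax {m : ℕ} = Polynomials (syntaxRing m)
  renaming (N₂ to N₂ˢ; n₂ to n₂ˢ; p₂ to p₂ˢ; q₂ to q₂ˢ; r₂ to r₂ˢ
           ; _^_ to infixr 9 _^ˢ_)
open Syntax

conℕ : ∀ {m} → ℕ → Polynomial m
conℕ n = con (+ n ℚ./ 1)

hornerˢ : ∀ {m} → List ℕ → Polynomial m → Polynomial m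
hornerˢ []       x = con 0ℚ
hornerˢ (c ∷ cs) x = conℕ c :+ x :* hornerˢ cs x

q₂≈horner : ∀ s → q₂ s ≈ horner (1 ∷ 2 ∷ 3 ∷ 3 ∷ 2 ∷ []) s
q₂≈horner = solve 1 (λ s → q₂ˢ s := hornerˢ (1 ∷ 2 ∷ 3 ∷ 3 ∷ 2 ∷ []) s) ≈-refl

q₂-mono-≤ : ∀ {s t} → 0ℝ ≤ s → s ≤ t → q₂ s ≤ q₂ t
q₂-mono-≤ {s} {t} 0≤s s≤t = ≤-respˡ (≈-sym (q₂≈horner s)) (≤-respʳ (≈-sym (q₂≈horner t))
  (horner-mono-≤ (1 ∷ 2 ∷ 3 ∷ 3 ∷ 2 ∷ []) 0≤s s≤t))

q₂-mono-< : ∀ {s t} → 0ℝ ≤ s → s < t → q₂ s < q₂ t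
q₂-mono-< {s} {t} 0≤s s<t = <-respˡ (≈-sym (q₂≈horner s)) (<-respʳ (≈-sym (q₂≈horner t))
  (horner-mono-< 1 1 (3 ∷ 3 ∷ 2 ∷ []) 0≤s s<t))

q₂-cancel-≤ : ∀ {s t} → 0ℝ ≤ t → q₂ s ≤ q₂ t → s ≤ t
q₂-cancel-≤ 0≤t qs≤qt = ≮⇒≥ λ t<s → <⇒≱ (q₂-mono-< 0≤t t<s) qs≤qt

n₂-mono-< : ∀ {s t} → 0ℝ ≤ s → s < t → n₂ s < n₂ t
n₂-mono-< {s} {t} 0≤s s<t = <-respˡ (≈-sym (eq s)) (<-respʳ (≈-sym (eq t))
  (horner-mono-< 1 5 (21 ∷ 49 ∷ 85 ∷ 113 ∷ 117 ∷ 92 ∷ 53 ∷ 20 ∷ 4 ∷ []) 0≤s s<t))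
  where
  eq : ∀ s → n₂ s ≈ horner (1 ∷ 6 ∷ 21 ∷ 49 ∷ 85 ∷ 113 ∷ 117 ∷ 92 ∷ 53 ∷ 20 ∷ 4 ∷ []) s
  eq = solve 1 (λ s → n₂ˢ s :=
    hornerˢ (1 ∷ 6 ∷ 21 ∷ 49 ∷ 85 ∷ 113 ∷ 117 ∷ 92 ∷ 53 ∷ 20 ∷ 4 ∷ []) s) ≈-refl

n₂-cancel-≤ : ∀ {s t} → 0ℝ ≤ t → n₂ s ≤ n₂ t → s ≤ t
n₂-cancel-≤ 0≤t ns≤nt = ≮⇒≥ λ t<s → <⇒≱ (n₂-mono-< 0≤t t<s) ns≤nt

-- The coefficients of `N₂` alternate in sign in powers of x, but are positive in powers of x - 1.
N₂-mono-< : ∀ {x y} → 1ℝ ≤ x → x < y → N₂ x < N₂ y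
N₂-mono-< {x} {y} 1≤x x<y = <-respˡ (≈-sym (eq x)) (<-respʳ (≈-sym (eq y))
  (horner-mono-< 1 5 (15 ∷ 19 ∷ 13 ∷ 4 ∷ []) (0≤y-x 1≤x) (+-monoˡ-< (- 1ℝ) x<y)))
  where
  eq : ∀ x → N₂ x ≈ horner (1 ∷ 6 ∷ 15 ∷ 19 ∷ 13 ∷ 4 ∷ []) (x - 1ℝ)
  eq = solve 1 (λ x → N₂ˢ x :=
    hornerˢ (1 ∷ 6 ∷ 15 ∷ 19 ∷ 13 ∷ 4 ∷ []) (x :- con 1ℚ)) ≈-refl

N₂-cancel-≤ : ∀ {x y} → 1ℝ ≤ y → N₂ x ≤ N₂ y → x ≤ y
N₂-cancel-≤ 1≤y Nx≤Ny = ≮⇒≥ λ y<x → <⇒≱ (N₂-mono-< 1≤y y<x) Nx≤Ny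

N₂-p₂ : ∀ s → N₂ (p₂ s) ≈ n₂ s
N₂-p₂ = solve 1 (λ s → N₂ˢ (p₂ˢ s) := n₂ˢ s) ≈-refl

-- Powers, roots and the substitution x = `p₂ s`

^-nonneg : ∀ {x} m → 0ℝ ≤ x → 0ℝ ≤ x ^ m
^-nonneg zero    0≤x = fromℕ-nonneg 1
^-nonneg (suc m) 0≤x = *-nonneg 0≤x (^-nonneg m 0≤x)

^-pos : ∀ {x} m → 0ℝ < x → 0ℝ < x ^ m
^-pos zero    0<x = fromℕ-mono-< {0} {1} ℕ.z<s
^-pos (suc m) 0<x = *-pos 0<x (^-pos m 0<x)

^-mono-≤ : ∀ {x y} m → 0ℝ ≤ x → x ≤ y → x ^ m ≤ y ^ m
^-mono-≤ zero    0≤x x≤y = ≤-refl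
^-mono-≤ (suc m) 0≤x x≤y = *-mono-≤ 0≤x x≤y (^-nonneg m 0≤x) (^-mono-≤ m 0≤x x≤y)

^-mono-< : ∀ {x y} m → 0ℝ ≤ x → x < y → x ^ suc m < y ^ suc m
^-mono-< m 0≤x x<y = *-mono-<-≤ 0≤x x<y (^-nonneg m 0≤x) (^-mono-≤ m 0≤x (<⇒≤ x<y))
  (^-pos m (≤-<-trans 0≤x x<y))

^-cancel-≤ : ∀ {x y} m → 0ℝ ≤ y → x ^ suc m ≤ y ^ suc m → x ≤ y
^-cancel-≤ m 0≤y x^≤y^ = ≮⇒≥ λ y<x → <⇒≱ (^-mono-< m 0≤y y<x) x^≤y^

-- Reduces the evaluation of a root to a polynomial identity for the candidate z, whose
-- nonnegativity also yields y ≥ 0.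
root-unique : ∀ m {y z} → 0ℝ ≤ z → z ^ suc m ≈ y → root (suc m) y ≈ z
root-unique m {y} {z} 0≤z z^≈y = ≤-antisym
  (^-cancel-≤ m 0≤z (≈⇒≤ (≈-trans root^≈y (≈-sym z^≈y))))
  (^-cancel-≤ m (0≤root m y) (≈⇒≤ (≈-trans z^≈y (≈-sym root^≈y))))
  where
  root^≈y : root (suc m) y ^ suc m ≈ y
  root^≈y = root-^ m (≤-respʳ z^≈y (^-nonneg (suc m) 0≤z))

1≤p₂ : ∀ {s} → 0ℝ ≤ s → 1ℝ ≤ p₂ s
1≤p₂ {s} 0≤s = ≤-by (+-nonneg (^-nonneg 2 0≤s) 0≤s)
  (solve 1 (λ s → con 1ℚ :+ (s ^ˢ 2 :+ s) := p₂ˢ s) ≈-refl s)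

-- `p₂ s` - 3/4 = (s + 1/2)², so the root in `Q₂` becomes s + 1/2.
Q₂-p₂ : ∀ {x s} → 0ℝ ≤ s → x ≈ p₂ s → Q₂ x ≈ q₂ s
Q₂-p₂ {x} {s} 0≤s x≈p = ≈-trans
  (+-cong (*-cong (+-cong x≈p ≈-refl)
    (+-cong (+-cong (*-cong ≈-refl x≈p) ≈-refl) (-‿cong √≈))) ≈-refl)
  (solve 1 (λ s → (p₂ˢ s :- conℕ 1) :* (conℕ 2 :* p₂ˢ s :+ con ½ :- (s :+ con ½)) :+ conℕ 1 := q₂ˢ s)
    ≈-refl s)
  where
  √≈ : √ (x - fromℚ (+ 3 ℚ./ 4)) ≈ s + fromℚ ½
  √≈ = root-unique 1 (+-nonneg 0≤s (0≤fromℚ ½))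
    (≈-trans (solve 1 (λ s → (s :+ con ½) ^ˢ 2 := p₂ˢ s :- con (+ 3 ℚ./ 4)) ≈-refl s)
      (+-cong (≈-sym x≈p) ≈-refl))

-- `N₂` takes the value y at both points, and it is injective on [1, ∞).
N₂⁻¹≈p₂-n₂⁻¹ : ∀ {y} → 1ℝ ≤ y → N₂⁻¹ y ≈ p₂ (n₂⁻¹ y)
N₂⁻¹≈p₂-n₂⁻¹ {y} 1≤y = ≤-antisym
  (N₂-cancel-≤ (1≤p₂ (0≤n₂⁻¹ y)) (≈⇒≤ eq)) (N₂-cancel-≤ (1≤N₂⁻¹ y) (≈⇒≤ (≈-sym eq)))
  where
  eq : N₂ (N₂⁻¹ y) ≈ N₂ (p₂ (n₂⁻¹ y))
  eq = ≈-trans (N₂-N₂⁻¹ 1≤y) (≈-trans (≈-sym (n₂-n₂⁻¹ 1≤y)) (≈-sym (N₂-p₂ (n₂⁻¹ y))))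

-- The explicit bound in terms of a tenth root

-- t² ≥ x - 7/20 + 1 / 10x with x = v + 1, multiplied by 20x.
tenth-root-bound : ∀ {v t} → 0ℝ ≤ v → 0ℝ ≤ t → N₂ (v + 1ℝ) ≈ fromℕ 4 * t ^ 10 →
  horner (15 ∷ 33 ∷ 20 ∷ []) v ≤ fromℕ 20 * (v + 1ℝ) * (t * t)
tenth-root-bound {v} {t} 0≤v 0≤t N≈4t¹⁰ = ^-cancel-≤ 4
  (*-nonneg (*-nonneg (fromℕ-nonneg 20) 0≤x) (*-nonneg 0≤t 0≤t))
  (*-cancelʳ-≤ (fromℕ-mono-< {0} {4} ℕ.z<s)
    (≤-by (horner-nonneg cs 0≤v) (≈-trans (gap v) (≈-trans (*-cong ≈-refl N≈4t¹⁰)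
      (solve 2 (λ x t → (conℕ 20 :* x) ^ˢ 5 :* (conℕ 4 :* t ^ˢ 10) :=
        (conℕ 20 :* x :* (t :* t)) ^ˢ 5 :* conℕ 4) ≈-refl (v + 1ℝ) t)))))
  where
  0≤x : 0ℝ ≤ v + 1ℝ
  0≤x = +-nonneg 0≤v (fromℕ-nonneg 1)

  cs : List ℕ
  cs = 162500 ∷ 1787500 ∷ 8735000 ∷ 23167000 ∷ 35763700 ∷ 32570428 ∷ 16751600 ∷ 4208000 ∷ 320000 ∷ []

  -- At infinity the fifth root of `N₂ x` / 4 is x - 7/20 + 21/(200 x) + O(1/x²). Taking 1/10
  -- instead of 21/200 leaves a difference with positive coefficients in v.
  gap : ∀ v → horner (15 ∷ 33 ∷ 20 ∷ []) v ^ 5 * fromℕ 4 + horner cs v ≈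
    (fromℕ 20 * (v + 1ℝ)) ^ 5 * N₂ (v + 1ℝ)
  gap = solve 1 (λ v → hornerˢ (15 ∷ 33 ∷ 20 ∷ []) v ^ˢ 5 :* conℕ 4 :+ hornerˢ cs v :=
    (conℕ 20 :* (v :+ con 1ℚ)) ^ˢ 5 :* N₂ˢ (v :+ con 1ℚ)) ≈-refl

-- The bound t ≥ (2s + 1)(5v + 2) / 2(5v + 1) with v = s² + s, which
-- agrees with the tenth root of n₂ s / 4 at infinity up to O(1 / s³).
tenth-root-bound′ : ∀ {s t} → fromℚ (+ 7 ℚ./ 10) ≤ s → 0ℝ ≤ t → n₂ s ≈ fromℕ 4 * t ^ 10 →
  horner (2 ∷ 9 ∷ 15 ∷ 10 ∷ []) s ≤ horner (2 ∷ 10 ∷ 10 ∷ []) s * t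
tenth-root-bound′ {s} {t} 7/10≤s 0≤t n≈4t¹⁰ = ^-cancel-≤ 1
  (*-nonneg (horner-nonneg (2 ∷ 10 ∷ 10 ∷ []) 0≤s) 0≤t)
  (*-cancelʳ-≤ (fromℕ-mono-< {0} {5} ℕ.z<s) (*-cancelʳ-≤ 0<x
    (≤-by (+-nonneg
        (*-nonneg (0≤y-x (tenth-root-bound 0≤v 0≤t (≈-trans (N₂-v s) n≈4t¹⁰))) (*-nonneg 0≤e 0≤e))
        (+-nonneg (*-nonneg 0≤δ (+-nonneg (*-nonneg (fromℕ-nonneg 20) 0≤v) (0≤fromℚ (+ 34 ℚ./ 5))))
          (0≤fromℚ (+ 773 ℚ./ 250))))
      (identity s t))))
  where
  v = s * s + s

  0≤s : 0ℝ ≤ s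
  0≤s = ≤-trans (0≤fromℚ (+ 7 ℚ./ 10)) 7/10≤s

  -- Squaring leaves 20 v² - 17 v - 5 to be bounded below. The product here is v - 119/100, and
  -- 119/100 is the value of v at s = 7/10.
  0≤δ : 0ℝ ≤ (s - fromℚ (+ 7 ℚ./ 10)) * (s + fromℚ (+ 17 ℚ./ 10))
  0≤δ = *-nonneg (0≤y-x 7/10≤s) (+-nonneg 0≤s (0≤fromℚ (+ 17 ℚ./ 10)))

  0≤v : 0ℝ ≤ v
  0≤v = +-nonneg (*-nonneg 0≤s 0≤s) 0≤s

  0<x : 0ℝ < v + 1ℝ
  0<x = <-respʳ (+-comm 1ℝ v)
    (+-pos-nonneg (fromℕ-mono-< {0} {1} ℕ.z<s) 0≤v)

  0≤e : 0ℝ ≤ horner (1 ∷ 5 ∷ []) v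
  0≤e = horner-nonneg (1 ∷ 5 ∷ []) 0≤v

  N₂-v : ∀ s → N₂ (s * s + s + 1ℝ) ≈ n₂ s
  N₂-v = solve 1 (λ s → N₂ˢ (s :* s :+ s :+ con 1ℚ) := n₂ˢ s) ≈-refl

  -- t² exceeds (s + 1/2)² = v + 1/4 by about 2/5; this is the origin of the factor 1 + 1/(5v + 1)
  -- on s + 1/2.
  identity : ∀ s t → let v = s * s + s in
    horner (2 ∷ 9 ∷ 15 ∷ 10 ∷ []) s ^ 2 * fromℕ 5 * (v + 1ℝ) +
    ((fromℕ 20 * (v + 1ℝ) * (t * t) - horner (15 ∷ 33 ∷ 20 ∷ []) v) *
      (horner (1 ∷ 5 ∷ []) v * horner (1 ∷ 5 ∷ []) v) +
    ((s - fromℚ (+ 7 ℚ./ 10)) * (s + fromℚ (+ 17 ℚ./ 10)) * (fromℕ 20 * v + fromℚ (+ 34 ℚ./ 5)) +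
      fromℚ (+ 773 ℚ./ 250))) ≈
    (horner (2 ∷ 10 ∷ 10 ∷ []) s * t) ^ 2 * fromℕ 5 * (v + 1ℝ)
  identity = solve 2 (λ s t → let v = s :* s :+ s in
    hornerˢ (2 ∷ 9 ∷ 15 ∷ 10 ∷ []) s ^ˢ 2 :* conℕ 5 :* (v :+ con 1ℚ) :+
    ((conℕ 20 :* (v :+ con 1ℚ) :* (t :* t) :- hornerˢ (15 ∷ 33 ∷ 20 ∷ []) v) :*
      (hornerˢ (1 ∷ 5 ∷ []) v :* hornerˢ (1 ∷ 5 ∷ []) v) :+
    ((s :- con (+ 7 ℚ./ 10)) :* (s :+ con (+ 17 ℚ./ 10)) :* (conℕ 20 :* v :+ con (+ 34 ℚ./ 5)) :+
      con (+ 773 ℚ./ 250))) :=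
    (hornerˢ (2 ∷ 10 ∷ 10 ∷ []) s :* t) ^ˢ 2 :* conℕ 5 :* (v :+ con 1ℚ)) ≈-refl

-- 20 D⁴ B(1 + f / D) for B(t) = 2t⁴ - t³ - t²/10 + 17t/20; all coefficients
-- are positive, so B increases on [1, ∞).
homogenised : ℝ → ℝ → ℝ
homogenised D f = D ^ 4 * fromℕ 35 + (D ^ 3 * fromℕ 113 * f + (D ^ 2 * fromℕ 178 * f ^ 2 +
  (D * fromℕ 140 * f ^ 3 + fromℕ 40 * f ^ 4)))

homogenised-mono : ∀ {D f g} → 0ℝ ≤ D → 0ℝ ≤ f → f ≤ g → homogenised D f ≤ homogenised D g
homogenised-mono {D} {f} {g} 0≤D 0≤f f≤g = +-mono-≤ ≤-refl
  (+-mono-≤ (term (*-nonneg (^-nonneg 3 0≤D) (fromℕ-nonneg 113)) 0≤f f≤g)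
  (+-mono-≤ (term (*-nonneg (^-nonneg 2 0≤D) (fromℕ-nonneg 178)) (^-nonneg 2 0≤f) (^-mono-≤ 2 0≤f f≤g))
  (+-mono-≤ (term (*-nonneg 0≤D (fromℕ-nonneg 140)) (^-nonneg 3 0≤f) (^-mono-≤ 3 0≤f f≤g))
            (term (fromℕ-nonneg 40) (^-nonneg 4 0≤f) (^-mono-≤ 4 0≤f f≤g)))))
  where
  term : ∀ {c x y} → 0ℝ ≤ c → 0ℝ ≤ x → x ≤ y → c * x ≤ c * y
  term 0≤c 0≤x x≤y = *-mono-≤ 0≤c ≤-refl 0≤x x≤y

-- M / D is the lower bound for t, and M / D ≥ 1 lies where B increases, so B(M / D) ≤ B(t). In B(M
-- / D) - `q₂ s` the numerator cancels down to degree 8, the degree of 20 D⁴, and the margin tends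
-- to 1/50.
q₂≤tenth-root-polynomial : ∀ {s t} → fromℚ (+ 7 ℚ./ 10) ≤ s → 0ℝ ≤ t → n₂ s ≈ fromℕ 4 * t ^ 10 →
  q₂ s ≤ fromℕ 2 * t ^ 4 - t ^ 3 - fromℚ (+ 1 ℚ./ 10) * t ^ 2 + fromℚ (+ 17 ℚ./ 20) * t
q₂≤tenth-root-polynomial {s} {t} 7/10≤s 0≤t n≈4t¹⁰ = *-cancelʳ-≤ 0<20D⁴ (begin
  q₂ s * (fromℕ 20 * D ^ 4)  ≤⟨ ≤-by (*-nonneg (fromℕ-nonneg 4) (horner-nonneg cs 0≤s)) (gap s) ⟩
  homogenised D (M - D)
    ≤⟨ homogenised-mono (<⇒≤ 0<D) 0≤M-D (+-monoˡ-≤ (- D) (tenth-root-bound′ 7/10≤s 0≤t n≈4t¹⁰)) ⟩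
  homogenised D (D * t - D)  ≈⟨ homogenised-D*t-D D t ⟩
  (fromℕ 2 * t ^ 4 - t ^ 3 - fromℚ (+ 1 ℚ./ 10) * t ^ 2 + fromℚ (+ 17 ℚ./ 20) * t) * (fromℕ 20 * D ^ 4) ∎)
  where
  open ≤-Reasoning
  D = horner (2 ∷ 10 ∷ 10 ∷ []) s
  M = horner (2 ∷ 9 ∷ 15 ∷ 10 ∷ []) s

  cs : List ℕ
  cs = 60 ∷ 814 ∷ 4678 ∷ 14560 ∷ 26220 ∷ 27300 ∷ 15800 ∷ 5000 ∷ 1000 ∷ []

  0≤s : 0ℝ ≤ s
  0≤s = ≤-trans (0≤fromℚ (+ 7 ℚ./ 10)) 7/10≤s

  0<D : 0ℝ < D
  0<D = horner-pos 1 (10 ∷ 10 ∷ []) 0≤s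

  0<20D⁴ : 0ℝ < fromℕ 20 * D ^ 4
  0<20D⁴ = *-pos (fromℕ-mono-< {0} {20} ℕ.z<s) (^-pos 4 0<D)

  0≤M-D : 0ℝ ≤ M - D
  0≤M-D = ≤-respʳ
    (solve 1 (λ s → s :* (conℕ 10 :* (s :* s) :+ (conℕ 5 :* (s :- con (+ 7 ℚ./ 10)) :+ con (+ 5 ℚ./ 2))) :=
      hornerˢ (2 ∷ 9 ∷ 15 ∷ 10 ∷ []) s :- hornerˢ (2 ∷ 10 ∷ 10 ∷ []) s) ≈-refl s)
    (*-nonneg 0≤s (+-nonneg (*-nonneg (fromℕ-nonneg 10) (*-nonneg 0≤s 0≤s))
      (+-nonneg (*-nonneg (fromℕ-nonneg 5) (0≤y-x 7/10≤s))
        (0≤fromℚ (+ 5 ℚ./ 2)))))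

  homogenisedˢ : ∀ {m} → Polynomial m → Polynomial m → Polynomial m
  homogenisedˢ D f = D ^ˢ 4 :* conℕ 35 :+ (D ^ˢ 3 :* conℕ 113 :* f :+ (D ^ˢ 2 :* conℕ 178 :* f ^ˢ 2 :+
    (D :* conℕ 140 :* f ^ˢ 3 :+ conℕ 40 :* f ^ˢ 4)))

  gap : ∀ s → let D = horner (2 ∷ 10 ∷ 10 ∷ []) s
                  M = horner (2 ∷ 9 ∷ 15 ∷ 10 ∷ []) s in
    q₂ s * (fromℕ 20 * D ^ 4) + fromℕ 4 * horner cs s ≈ homogenised D (M - D)
  gap = solve 1 (λ s → let D = hornerˢ (2 ∷ 10 ∷ 10 ∷ []) s
                           M = hornerˢ (2 ∷ 9 ∷ 15 ∷ 10 ∷ []) s in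
    q₂ˢ s :* (conℕ 20 :* D ^ˢ 4) :+ conℕ 4 :* hornerˢ cs s := homogenisedˢ D (M :- D)) ≈-refl

  homogenised-D*t-D : ∀ D t → homogenised D (D * t - D) ≈
    (fromℕ 2 * t ^ 4 - t ^ 3 - fromℚ (+ 1 ℚ./ 10) * t ^ 2 + fromℚ (+ 17 ℚ./ 20) * t) * (fromℕ 20 * D ^ 4)
  homogenised-D*t-D = solve 2 (λ D t → homogenisedˢ D (D :* t :- D) :=
    (conℕ 2 :* t ^ˢ 4 :- t ^ˢ 3 :- con (+ 1 ℚ./ 10) :* t ^ˢ 2 :+ con (+ 17 ℚ./ 20) :* t) :* (conℕ 20 :* D ^ˢ 4)) ≈-refl

-- Comparison of n with n₂

square-nonneg : ∀ x → 0ℝ ≤ x * x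
square-nonneg x = ≤-by-cases 0ℝ x (λ 0≤x → *-nonneg 0≤x 0≤x) λ x<0 →
  ≤-respʳ (solve 1 (λ x → (con 0ℚ :- x) :* (con 0ℚ :- x) := x :* x) ≈-refl x)
    (*-nonneg (0≤y-x (<⇒≤ x<0)) (0≤y-x (<⇒≤ x<0)))

p₂≥0 : ∀ {s} → 0ℝ ≤ s → 0ℝ ≤ p₂ s
p₂≥0 0≤s = ≤-trans (fromℕ-nonneg 1) (1≤p₂ 0≤s)

q₂>0 : ∀ {s} → 0ℝ ≤ s → 0ℝ < q₂ s
q₂>0 {s} 0≤s = <-respʳ (≈-sym (q₂≈horner s)) (horner-pos 0 (2 ∷ 3 ∷ 3 ∷ 2 ∷ []) 0≤s)

r₂>0 : ∀ {s} → 0ℝ ≤ s → 0ℝ < r₂ s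
r₂>0 {s} 0≤s = <-respʳ (solve 1 (λ s → hornerˢ (1 ∷ 3 ∷ 6 ∷ 5 ∷ 2 ∷ []) s := r₂ˢ s) ≈-refl s)
  (horner-pos 0 (3 ∷ 6 ∷ 5 ∷ 2 ∷ []) 0≤s)

x≤1+x : ∀ x → x ≤ 1ℝ + x
x≤1+x x = ≤-by (fromℕ-nonneg 1) (+-comm x 1ℝ)

x≈1+x-1 : ∀ x → x ≈ 1ℝ + x - 1ℝ
x≈1+x-1 = solve 1 (λ x → x := con 1ℚ :+ x :- con 1ℚ) ≈-refl

-- X, Q and R stand for P - 1, q - 1 and r - 1.
module Extremal {X Q R e α γ : ℝ} (0<X : 0ℝ < X) (0≤e : 0ℝ ≤ e) (0≤α : 0ℝ ≤ α) (0≤γ : 0ℝ ≤ γ)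
  (P≈ : 1ℝ + X ≈ e + α) (e≈ : e * (1ℝ + γ) ≈ 1ℝ + α * α)
  (Q≈ : Q ≈ X * (1ℝ + X + e))
  (R≈ : R ≈ X * (1ℝ + X + (1ℝ + X + (1ℝ + (α + γ))))) where

  open ≤-Reasoning

  private
    0≤X : 0ℝ ≤ X
    0≤X = <⇒≤ 0<X

    e≤ : e ≤ 1ℝ + α * α
    e≤ = ≤-respʳ e≈ (≤-by (*-nonneg 0≤e 0≤γ)
      (solve 2 (λ e c → e :+ e :* c := e :* (con 1ℚ :+ c)) ≈-refl e γ))

    P+e≈ : 1ℝ + X + e ≈ fromℕ 2 * (1ℝ + X) - α
    P+e≈ = ≈-trans (solve 3 (λ P e a → P :+ e := P :+ (e :+ a) :- a) ≈-refl (1ℝ + X) e α)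
      (≈-trans (+-cong (+-cong ≈-refl (≈-sym P≈)) ≈-refl)
        (solve 2 (λ P a → P :+ P :- a := conℕ 2 :* P :- a) ≈-refl (1ℝ + X) α))

  -- P - 1 ≤ a² + a and P + E ≤ 2a² + a + 2, and these bounds are the two factors of `q₂ a` - 1.
  q≤q₂α : 1ℝ + Q ≤ q₂ α
  q≤q₂α = begin
    1ℝ + Q                 ≈⟨ +-cong ≈-refl Q≈ ⟩
    1ℝ + X * (1ℝ + X + e)  ≤⟨ +-mono-≤ (≤-refl {1ℝ}) (*-mono-≤ 0≤X X≤
                               (+-nonneg (≤-trans 0≤X (x≤1+x X)) 0≤e) (+-mono-≤ (+-mono-≤ ≤-refl X≤) e≤)) ⟩
    1ℝ + (α * α + α) * (1ℝ + (α * α + α) + (1ℝ + α * α))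
                           ≈⟨ solve 1 (λ a → con 1ℚ :+ (a :* a :+ a) :* (con 1ℚ :+ (a :* a :+ a) :+ (con 1ℚ :+ a :* a))
                                := q₂ˢ a) ≈-refl α ⟩
    q₂ α                   ∎
    where
    X≤ : X ≤ α * α + α
    X≤ = begin
      X                       ≈⟨ x≈1+x-1 X ⟩
      1ℝ + X - 1ℝ             ≈⟨ +-cong P≈ ≈-refl ⟩
      e + α - 1ℝ              ≤⟨ +-monoˡ-≤ (- 1ℝ) (+-monoˡ-≤ α e≤) ⟩
      1ℝ + α * α + α - 1ℝ
        ≈⟨ solve 1 (λ a → con 1ℚ :+ a :* a :+ a :- con 1ℚ := a :* a :+ a) ≈-refl α ⟩
      α * α + α               ∎

  module _ {s : ℝ} (0≤s : 0ℝ ≤ s) (q₂≤q : q₂ s ≤ 1ℝ + Q) where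

    s≤α : s ≤ α
    s≤α = q₂-cancel-≤ 0≤α (≤-trans q₂≤q q≤q₂α)

    -- q - 1 = (P - 1)(2P - a) and `q₂ s` - 1 = (`p₂ s` - 1)(2 `p₂ s` - s). If P < `p₂ s`, then a ≥
    -- s puts the second factor of q - 1 below its counterpart as well.
    p₂≤P : p₂ s ≤ 1ℝ + X
    p₂≤P = ≮⇒≥ λ P<p₂ → <⇒≱ (begin-strict
      1ℝ + Q                                      ≈⟨ +-cong ≈-refl Q≈ ⟩
      1ℝ + X * (1ℝ + X + e)                       ≈⟨ +-comm _ _ ⟩
      X * (1ℝ + X + e) + 1ℝ                       <⟨ +-monoˡ-< 1ℝ (*-mono-<-≤ 0≤X (X< P<p₂)
                                                       (+-nonneg (≤-trans 0≤X (x≤1+x X)) 0≤e) (P+e≤ P<p₂)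
                                                       (horner-pos 1 (1 ∷ 2 ∷ []) 0≤s)) ⟩
      (s * s + s) * horner (2 ∷ 1 ∷ 2 ∷ []) s + 1ℝ
        ≈⟨ solve 1 (λ s → (s :* s :+ s) :* hornerˢ (2 ∷ 1 ∷ 2 ∷ []) s :+ con 1ℚ
                                                        := q₂ˢ s) ≈-refl s ⟩
      q₂ s ∎) q₂≤q
      where
      X< : 1ℝ + X < p₂ s → X < s * s + s
      X< P<p₂ = begin-strict
        X                ≈⟨ x≈1+x-1 X ⟩
        1ℝ + X - 1ℝ      <⟨ +-monoˡ-< (- 1ℝ) P<p₂ ⟩
        p₂ s - 1ℝ        ≈⟨ solve 1 (λ s → p₂ˢ s :- con 1ℚ := s :* s :+ s) ≈-refl s ⟩
        s * s + s        ∎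
      P+e≤ : 1ℝ + X < p₂ s → 1ℝ + X + e ≤ horner (2 ∷ 1 ∷ 2 ∷ []) s
      P+e≤ P<p₂ = ≤-by
        (+-nonneg (+-nonneg (0≤y-x (<⇒≤ P<p₂)) (0≤y-x (<⇒≤ P<p₂))) (0≤y-x s≤α))
        (≈-trans (+-cong P+e≈ ≈-refl) (solve 3 (λ P a s →
          conℕ 2 :* P :- a :+ ((p₂ˢ s :- P) :+ (p₂ˢ s :- P) :+ (a :- s)) := hornerˢ (2 ∷ 1 ∷ 2 ∷ []) s)
          ≈-refl (1ℝ + X) α s))

    -- r - 1 = (P - 1)(P + F) with F = P + 1 + a + c increases in P, a and c; `r₂ s` is the value of
    -- r at `p₂ s`, s and 0.
    r₂≤r : r₂ s ≤ 1ℝ + R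
    r₂≤r = begin
      r₂ s
        ≈⟨ solve 1 (λ s → r₂ˢ s := con 1ℚ :+ (s :* s :+ s) :* (p₂ˢ s :+ (p₂ˢ s :+ (con 1ℚ :+ (s :+ con 0ℚ))))) ≈-refl s ⟩
      1ℝ + (s * s + s) * (p₂ s + (p₂ s + (1ℝ + (s + 0ℝ))))
            ≤⟨ +-mono-≤ (≤-refl {1ℝ}) (*-mono-≤ (+-nonneg (*-nonneg 0≤s 0≤s) 0≤s) v≤X
                 (+-nonneg (p₂≥0 0≤s) (+-nonneg (p₂≥0 0≤s) (+-nonneg (fromℕ-nonneg 1) (+-nonneg 0≤s ≤-refl))))
                 (+-mono-≤ p₂≤P (+-mono-≤ p₂≤P (+-mono-≤ (≤-refl {1ℝ}) (+-mono-≤ s≤α 0≤γ))))) ⟩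
      1ℝ + X * (1ℝ + X + (1ℝ + X + (1ℝ + (α + γ))))  ≈⟨ +-cong ≈-refl (≈-sym R≈) ⟩
      1ℝ + R ∎
      where
      v≤X : s * s + s ≤ X
      v≤X = ≤-by (0≤y-x p₂≤P) (solve 2 (λ s x → (s :* s :+ s) :+ (con 1ℚ :+ x :- p₂ˢ s) := x) ≈-refl s X)

  q₂<q⇒n₂<n : ∀ {s} → 0ℝ ≤ s → q₂ s < 1ℝ + Q → n₂ s < (1ℝ + X) * (1ℝ + Q) * (1ℝ + R)
  q₂<q⇒n₂<n {s} 0≤s q₂<q = *-mono-<-≤ (*-nonneg (p₂≥0 0≤s) (<⇒≤ (q₂>0 0≤s)))
    (<-respˡ (*-comm (q₂ s) (p₂ s)) (<-respʳ (*-comm (1ℝ + Q) (1ℝ + X))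
      (*-mono-<-≤ (<⇒≤ (q₂>0 0≤s)) q₂<q (p₂≥0 0≤s) p₂≤P′
        (<-≤-trans (<-≤-trans (fromℕ-mono-< {0} {1} ℕ.z<s) (1≤p₂ 0≤s)) p₂≤P′))))
    (<⇒≤ (r₂>0 0≤s)) r₂≤r′ (<-≤-trans (r₂>0 0≤s) r₂≤r′)
    where
    p₂≤P′ = p₂≤P 0≤s (<⇒≤ q₂<q)
    r₂≤r′ = r₂≤r 0≤s (<⇒≤ q₂<q)

  -- No factor of n is below its counterpart in `n₂ s`, so P > `p₂ s` would make the product too
  -- large.
  q≈q₂⇒P≈p₂ : ∀ {s} → 0ℝ ≤ s → 1ℝ + Q ≈ q₂ s → (1ℝ + X) * (1ℝ + Q) * (1ℝ + R) ≈ n₂ s → 1ℝ + X ≈ p₂ s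
  q≈q₂⇒P≈p₂ {s} 0≤s q≈q₂ n≈n₂ = ≤-antisym
    (≮⇒≥ λ p₂<P → <⇒≱
      (*-mono-<-≤ (*-nonneg (p₂≥0 0≤s) (<⇒≤ (q₂>0 0≤s)))
        (*-mono-<-≤ (p₂≥0 0≤s) p₂<P (<⇒≤ (q₂>0 0≤s)) q₂≤q (<-≤-trans (q₂>0 0≤s) q₂≤q))
        (<⇒≤ (r₂>0 0≤s)) (r₂≤r 0≤s q₂≤q) (<-≤-trans (r₂>0 0≤s) (r₂≤r 0≤s q₂≤q)))
      (≈⇒≤ n≈n₂))
    (p₂≤P 0≤s q₂≤q)
    where
    q₂≤q = ≈⇒≤ (≈-sym q≈q₂)

  module _ {s : ℝ} (P≈p₂ : 1ℝ + X ≈ p₂ s) (q≈q₂ : 1ℝ + Q ≈ q₂ s) where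
    private
      X≈ : X ≈ s * s + s
      X≈ = ≈-trans (x≈1+x-1 X)
        (≈-trans (+-cong P≈p₂ ≈-refl) (solve 1 (λ s → p₂ˢ s :- con 1ℚ := s :* s :+ s) ≈-refl s))

      P+e≈P+P-s : 1ℝ + X + e ≈ 1ℝ + X + (1ℝ + X) - s
      P+e≈P+P-s = *-cancelʳ-≈ 0<X (begin-equality
        (1ℝ + X + e) * X  ≈⟨ *-comm _ _ ⟩
        X * (1ℝ + X + e)  ≈⟨ Q≈ ⟨
        Q                 ≈⟨ x≈1+x-1 Q ⟩
        1ℝ + Q - 1ℝ       ≈⟨ +-cong q≈q₂ ≈-refl ⟩
        q₂ s - 1ℝ
          ≈⟨ solve 1 (λ s → q₂ˢ s :- con 1ℚ := (p₂ˢ s :+ p₂ˢ s :- s) :* (s :* s :+ s)) ≈-refl s ⟩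
        (p₂ s + p₂ s - s) * (s * s + s) ≈⟨ *-cong (+-cong (+-cong P≈p₂ P≈p₂) ≈-refl) X≈ ⟨
        (1ℝ + X + (1ℝ + X) - s) * X ∎)

    -- q forces P + E = 2P - s, and comparison with P = E + a isolates a.
    s≈α : s ≈ α
    s≈α = begin-equality
      s
        ≈⟨ solve 2 (λ P s → s := P :+ P :- (P :+ P :- s)) ≈-refl (1ℝ + X) s ⟩
      P + P - (P + P - s)               ≈⟨ +-cong (+-cong ≈-refl P≈) (-‿cong (≈-sym P+e≈P+P-s)) ⟩
      P + (e + α) - (P + e)
        ≈⟨ solve 3 (λ P e a → P :+ (e :+ a) :- (P :+ e) := a) ≈-refl P e α ⟩
      α ∎
      where P = 1ℝ + X

    e≈1+s² : e ≈ 1ℝ + s * s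
    e≈1+s² = begin-equality
      e                    ≈⟨ solve 2 (λ e a → e := e :+ a :- a) ≈-refl e α ⟩
      e + α - α            ≈⟨ +-cong (≈-trans (≈-sym P≈) P≈p₂) (-‿cong (≈-sym s≈α)) ⟩
      p₂ s - s             ≈⟨ solve 1 (λ s → p₂ˢ s :- s := con 1ℚ :+ s :* s) ≈-refl s ⟩
      1ℝ + s * s           ∎

    -- With E = s² + 1 and a = s, the equation E (1 + c) = a² + 1 leaves nothing for c; this then
    -- fixes r.
    γ≈0 : γ ≈ 0ℝ
    γ≈0 = *-cancelʳ-≈ 0<e (begin-equality
      γ * e                    ≈⟨ solve 2 (λ c e → c :* e := e :* (con 1ℚ :+ c) :- e) ≈-refl γ e ⟩
      e * (1ℝ + γ) - e         ≈⟨ +-cong e≈ (-‿cong e≈1+s²) ⟩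
      1ℝ + α * α - (1ℝ + s * s) ≈⟨ +-cong (+-cong ≈-refl (*-cong s≈α s≈α)) ≈-refl ⟨
      1ℝ + s * s - (1ℝ + s * s)
        ≈⟨ solve 2 (λ s e → con 1ℚ :+ s :* s :- (con 1ℚ :+ s :* s) := con 0ℚ :* e) ≈-refl s e ⟩
      0ℝ * e ∎)
      where
      0<e : 0ℝ < e
      0<e = <-respʳ (≈-sym e≈1+s²) (+-pos-nonneg (fromℕ-mono-< {0} {1} ℕ.z<s) (square-nonneg s))

    n≈n₂ : (1ℝ + X) * (1ℝ + Q) * (1ℝ + R) ≈ n₂ s
    n≈n₂ = *-cong (*-cong P≈p₂ q≈q₂) (begin-equality
      1ℝ + R                                          ≈⟨ +-cong ≈-refl R≈ ⟩
      1ℝ + X * (1ℝ + X + (1ℝ + X + (1ℝ + (α + γ))))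
        ≈⟨ +-cong ≈-refl (*-cong X≈ (+-cong P≈p₂ (+-cong P≈p₂ (+-cong ≈-refl (+-cong (≈-sym s≈α) γ≈0))))) ⟩
      1ℝ + (s * s + s) * (p₂ s + (p₂ s + (1ℝ + (s + 0ℝ))))
        ≈⟨ solve 1 (λ s → con 1ℚ :+ (s :* s :+ s) :* (p₂ˢ s :+ (p₂ˢ s :+ (con 1ℚ :+ (s :+ con 0ℚ)))) := r₂ˢ s) ≈-refl s ⟩
      r₂ s ∎)

-- The case C ≥ 2

module Dominated {X Q R : ℝ} (0<X : 0ℝ < X) (0≤Q : 0ℝ ≤ Q)
  (2Q≤ : fromℕ 2 * Q ≤ X * (1ℝ + X + X))
  (≤Pr : (1ℝ + X) * (1ℝ + Q) + (1ℝ + X) + Q ≤ (1ℝ + X) * (1ℝ + R)) where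

  open ≤-Reasoning

  private
    0≤X : 0ℝ ≤ X
    0≤X = <⇒≤ 0<X

  module _ {s : ℝ} (0≤s : 0ℝ ≤ s) (q₂≤q : q₂ s ≤ 1ℝ + Q) where
    private
      v A : ℝ
      v = s * s + s
      -- To leading order 2s⁴ ≤ q ≤ X², so X is at least √2 s². The constant 4/3 is a rational below
      -- √2; its excess over 1 is what makes P r exceed `p₂ s * r₂ s`.
      A = fromℚ (+ 4 ℚ./ 3) * v

      0≤v : 0ℝ ≤ v
      0≤v = +-nonneg (*-nonneg 0≤s 0≤s) 0≤s

      0≤A : 0ℝ ≤ A
      0≤A = *-nonneg (0≤fromℚ (+ 4 ℚ./ 3)) 0≤v

      A≤X : A ≤ X
      A≤X = ≮⇒≥ λ X<A → <⇒≱ (begin-strict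
        fromℕ 2 * Q                  ≤⟨ 2Q≤ ⟩
        X * (1ℝ + X + X)             <⟨ *-mono-<-≤ 0≤X X<A (+-nonneg (≤-trans 0≤X (x≤1+x X)) 0≤X)
                                          (+-mono-≤ (+-mono-≤ ≤-refl (<⇒≤ X<A)) (<⇒≤ X<A))
                                          (+-pos-nonneg (+-pos-nonneg (fromℕ-mono-< {0} {1} ℕ.z<s) 0≤A) 0≤A) ⟩
        A * (1ℝ + A + A)             ≤⟨ ≤-by (*-nonneg (*-nonneg (0≤fromℚ (+ 4 ℚ./ 9)) 0≤v)
                                          (+-nonneg (square-nonneg (s - fromℚ (+ 7 ℚ./ 4))) (0≤fromℚ (+ 47 ℚ./ 16))))
                                          (solve 1 (λ s → let v = s :* s :+ s ; A = con (+ 4 ℚ./ 3) :* v in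
                                            A :* (con 1ℚ :+ A :+ A) :+ con (+ 4 ℚ./ 9) :* v :*
                                              ((s :- con (+ 7 ℚ./ 4)) :* (s :- con (+ 7 ℚ./ 4)) :+ con (+ 47 ℚ./ 16))
                                              := conℕ 2 :* (q₂ˢ s :- con 1ℚ)) ≈-refl s) ⟩
        fromℕ 2 * (q₂ s - 1ℝ)        ≤⟨ *-mono-≤ (fromℕ-nonneg 2) ≤-refl
                                          (0≤y-x (1≤q₂ 0≤s)) (+-monoˡ-≤ (- 1ℝ) q₂≤q) ⟩
        fromℕ 2 * (1ℝ + Q - 1ℝ)
          ≈⟨ solve 1 (λ q → conℕ 2 :* (con 1ℚ :+ q :- con 1ℚ) := conℕ 2 :* q) ≈-refl Q ⟩
        fromℕ 2 * Q                  ∎) ≤-refl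
        where
        1≤q₂ : ∀ {s} → 0ℝ ≤ s → 1ℝ ≤ q₂ s
        1≤q₂ {s} 0≤s = ≤-by (*-nonneg 0≤s (horner-nonneg (2 ∷ 3 ∷ 3 ∷ 2 ∷ []) 0≤s)) (≈-sym (q₂≈horner s))

    -- `≤Pr` bounds P r as a whole, so n is compared as (P r) q with (`p₂ s * r₂ s`) `q₂ s`. The
    -- leading terms of the first factors are at least 8/3 s⁶ against 2 s⁶.
    n₂<n : n₂ s < (1ℝ + X) * (1ℝ + Q) * (1ℝ + R)
    n₂<n = begin-strict
      n₂ s                            ≈⟨ solve 1 (λ s → n₂ˢ s := p₂ˢ s :* r₂ˢ s :* q₂ˢ s) ≈-refl s ⟩
      p₂ s * r₂ s * q₂ s              <⟨ *-mono-<-≤ (*-nonneg (p₂≥0 0≤s) (<⇒≤ (r₂>0 0≤s))) p₂r₂<Pr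
                                           (<⇒≤ (q₂>0 0≤s)) q₂≤q (<-≤-trans (q₂>0 0≤s) q₂≤q) ⟩
      (1ℝ + X) * (1ℝ + R) * (1ℝ + Q)
        ≈⟨ solve 3 (λ P q r → P :* r :* q := P :* q :* r) ≈-refl (1ℝ + X) (1ℝ + Q) (1ℝ + R) ⟩
      (1ℝ + X) * (1ℝ + Q) * (1ℝ + R)  ∎
      where
      -- Completes the square in the difference of the first step, a sextic in s.
      w : ℝ
      w = s * (s * s) - fromℚ (+ 1 ℚ./ 4) * (s * s) - fromℚ (+ 4 ℚ./ 5) * s - fromℚ (+ 6 ℚ./ 5)

      p₂r₂<Pr : p₂ s * r₂ s < (1ℝ + X) * (1ℝ + R)
      p₂r₂<Pr = begin-strict
        p₂ s * r₂ s
          <⟨ <-by (*-pos (0<fromℚ (+ 1 ℚ./ 3)) (+-pos-nonneg (0<fromℚ (+ 3 ℚ./ 25))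
               (+-nonneg (*-nonneg (fromℕ-nonneg 2) (square-nonneg w))
                 (*-nonneg (0≤fromℚ (+ 1 ℚ./ 200)) (horner-nonneg (0 ∷ 832 ∷ 304 ∷ 0 ∷ 15 ∷ []) 0≤s)))))
               (solve 1 (λ s → let w = s :* (s :* s) :- con (+ 1 ℚ./ 4) :* (s :* s) :- con (+ 4 ℚ./ 5) :* s :- con (+ 6 ℚ./ 5) in
                 p₂ˢ s :* r₂ˢ s :+ con (+ 1 ℚ./ 3) :* (con (+ 3 ℚ./ 25) :+ (conℕ 2 :* (w :* w) :+
                   con (+ 1 ℚ./ 200) :* hornerˢ (0 ∷ 832 ∷ 304 ∷ 0 ∷ 15 ∷ []) s)) :=
                 (con 1ℚ :+ con (+ 4 ℚ./ 3) :* (s :* s :+ s)) :* (q₂ˢ s :+ con 1ℚ) :+ (q₂ˢ s :- con 1ℚ)) ≈-refl s) ⟩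
        (1ℝ + A) * (q₂ s + 1ℝ) + (q₂ s - 1ℝ)
          ≤⟨ +-mono-≤ (*-mono-≤ (≤-trans 0≤A (x≤1+x A)) (+-mono-≤ ≤-refl A≤X)
               (<⇒≤ (+-pos-nonneg (q₂>0 0≤s) (fromℕ-nonneg 1))) (+-monoˡ-≤ 1ℝ q₂≤q)) (+-monoˡ-≤ (- 1ℝ) q₂≤q) ⟩
        (1ℝ + X) * (1ℝ + Q + 1ℝ) + (1ℝ + Q - 1ℝ)
          ≈⟨ solve 2 (λ x q → (con 1ℚ :+ x) :* (con 1ℚ :+ q :+ con 1ℚ) :+ (con 1ℚ :+ q :- con 1ℚ) :=
               (con 1ℚ :+ x) :* (con 1ℚ :+ q) :+ (con 1ℚ :+ x) :+ q) ≈-refl X Q ⟩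
        (1ℝ + X) * (1ℝ + Q) + (1ℝ + X) + Q
          ≤⟨ ≤Pr ⟩
        (1ℝ + X) * (1ℝ + R) ∎

  -- At X = s² + s, `q₂ s` - 1 grows like 2X², while `2Q≤` allows only X² + X / 2.
  q≉q₂ : ∀ {s} → 0ℝ ≤ s → 1ℝ + X ≈ p₂ s → ¬ (1ℝ + Q ≈ q₂ s)
  q≉q₂ {s} 0≤s P≈p₂ q≈q₂ = <⇒≱ (begin-strict
    X * (1ℝ + X + X)                  <⟨ <-by (*-pos 0<X (+-pos-nonneg (fromℕ-mono-< {0} {3} ℕ.z<s)
                                           (*-nonneg (fromℕ-nonneg 2) (square-nonneg s)))) lhs ⟩
    fromℕ 2 * Q                       ∎) 2Q≤
    where
    X≈ : X ≈ s * s + s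
    X≈ = ≈-trans (x≈1+x-1 X)
      (≈-trans (+-cong P≈p₂ ≈-refl) (solve 1 (λ s → p₂ˢ s :- con 1ℚ := s :* s :+ s) ≈-refl s))
    lhs : X * (1ℝ + X + X) + X * (fromℕ 3 + fromℕ 2 * (s * s)) ≈ fromℕ 2 * Q
    lhs = begin-equality
      X * (1ℝ + X + X) + X * (fromℕ 3 + fromℕ 2 * (s * s))
        ≈⟨ +-cong (*-cong X≈ (+-cong (+-cong ≈-refl X≈) X≈)) (*-cong X≈ ≈-refl) ⟩
      (s * s + s) * (1ℝ + (s * s + s) + (s * s + s)) + (s * s + s) * (fromℕ 3 + fromℕ 2 * (s * s))
        ≈⟨ solve 1 (λ s → let v = s :* s :+ s in v :* (con 1ℚ :+ v :+ v) :+ v :* (conℕ 3 :+ conℕ 2 :* (s :* s)) :=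
             conℕ 2 :* (q₂ˢ s :- con 1ℚ)) ≈-refl s ⟩
      fromℕ 2 * (q₂ s - 1ℝ)           ≈⟨ *-cong ≈-refl (+-cong q≈q₂ ≈-refl) ⟨
      fromℕ 2 * (1ℝ + Q - 1ℝ)
        ≈⟨ solve 1 (λ q → conℕ 2 :* (con 1ℚ :+ q :- con 1ℚ) := conℕ 2 :* q) ≈-refl Q ⟩
      fromℕ 2 * Q                     ∎

-- The explicit bound as a polynomial in the tenth root

fromℕ-^ : ∀ m k → fromℕ (m ℕ.^ k) ≈ fromℕ m ^ k
fromℕ-^ m zero    = ≈-refl
fromℕ-^ m (suc k) = ≈-trans (fromℕ-* m (m ℕ.^ k)) (*-cong ≈-refl (fromℕ-^ m k))

fromℚ-/ : ∀ m d .{{_ : ℕ.NonZero d}} → fromℚ (+ m ℚ./ d) ≈ fromℕ m * fromℚ (+ 1 ℚ./ d)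
fromℚ-/ m d = ≡⇒≈ λ _ → ≡.trans (cong (λ z → + z ℚ./ d) (≡.sym (ℕ.*-identityʳ m))) (*-/ m 1 d)

^-cong : ∀ {x y} k → x ≈ y → x ^ k ≈ y ^ k
^-cong zero    x≈y = ≈-refl
^-cong (suc k) x≈y = *-cong x≈y (^-cong k x≈y)

module RootExpression {n : ℕ} {t : ℝ} (0≤t : 0ℝ ≤ t) (t¹⁰≈n/4 : t ^ 10 ≈ fromℚ (+ n ℚ./ 4)) where
  open ≤-Reasoning

  n≈4t¹⁰ : fromℕ n ≈ fromℕ 4 * t ^ 10
  n≈4t¹⁰ = begin-equality
    fromℕ n
      ≈⟨ solve 1 (λ n → n := conℕ 4 :* (n :* con (+ 1 ℚ./ 4))) ≈-refl (fromℕ n) ⟩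
    fromℕ 4 * (fromℕ n * fromℚ (+ 1 ℚ./ 4)) ≈⟨ *-cong ≈-refl (fromℚ-/ n 4) ⟨
    fromℕ 4 * fromℚ (+ n ℚ./ 4)            ≈⟨ *-cong ≈-refl t¹⁰≈n/4 ⟨
    fromℕ 4 * t ^ 10                       ∎

  [2t⁴]⁵≈2n² : (fromℕ 2 * t ^ 4) ^ 5 ≈ fromℕ (2 ℕ.* n ℕ.^ 2)
  [2t⁴]⁵≈2n² = begin-equality
    (fromℕ 2 * t ^ 4) ^ 5
      ≈⟨ solve 1 (λ t → (conℕ 2 :* t ^ˢ 4) ^ˢ 5 := conℕ 2 :* (conℕ 4 :* t ^ˢ 10) ^ˢ 2) ≈-refl t ⟩
    fromℕ 2 * (fromℕ 4 * t ^ 10) ^ 2 ≈⟨ *-cong ≈-refl (^-cong 2 n≈4t¹⁰) ⟨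
    fromℕ 2 * fromℕ n ^ 2        ≈⟨ *-cong ≈-refl (fromℕ-^ n 2) ⟨
    fromℕ 2 * fromℕ (n ℕ.^ 2)    ≈⟨ fromℕ-* 2 (n ℕ.^ 2) ⟨
    fromℕ (2 ℕ.* n ℕ.^ 2)        ∎

  [t³]¹⁰≈n³/64 : (t ^ 3) ^ 10 ≈ fromℚ (+ (n ℕ.^ 3) ℚ./ 64)
  [t³]¹⁰≈n³/64 = begin-equality
    (t ^ 3) ^ 10
      ≈⟨ solve 1 (λ t → (t ^ˢ 3) ^ˢ 10 := (conℕ 4 :* t ^ˢ 10) ^ˢ 3 :* con (+ 1 ℚ./ 64)) ≈-refl t ⟩
    (fromℕ 4 * t ^ 10) ^ 3 * fromℚ (+ 1 ℚ./ 64) ≈⟨ *-cong (^-cong 3 n≈4t¹⁰) ≈-refl ⟨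
    fromℕ n ^ 3 * fromℚ (+ 1 ℚ./ 64)  ≈⟨ *-cong (fromℕ-^ n 3) ≈-refl ⟨
    fromℕ (n ℕ.^ 3) * fromℚ (+ 1 ℚ./ 64) ≈⟨ fromℚ-/ (n ℕ.^ 3) 64 ⟨
    fromℚ (+ (n ℕ.^ 3) ℚ./ 64)   ∎

  -- All radicands are powers of t up to a constant: 2n² = (2t⁴)⁵, n³/64 = (t³)¹⁰ and n/4 = (t²)⁵ =
  -- t¹⁰.
  root-expression :
    root 5 (fromℕ (2 ℕ.* n ℕ.^ 2)) - root 10 (fromℚ (+ (n ℕ.^ 3) ℚ./ 64))
      - fromℚ (+ 1 ℚ./ 10) * root 5 (fromℚ (+ n ℚ./ 4)) + fromℚ (+ 17 ℚ./ 20) * root 10 (fromℚ (+ n ℚ./ 4))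
    ≈ fromℕ 2 * t ^ 4 - t ^ 3 - fromℚ (+ 1 ℚ./ 10) * t ^ 2 + fromℚ (+ 17 ℚ./ 20) * t
  root-expression = +-cong
    (+-cong
      (+-cong (root-unique 4 {fromℕ (2 ℕ.* n ℕ.^ 2)} (*-nonneg (fromℕ-nonneg 2) (^-nonneg 4 0≤t)) [2t⁴]⁵≈2n²)
        (-‿cong (root-unique 9 {fromℚ (+ (n ℕ.^ 3) ℚ./ 64)} (^-nonneg 3 0≤t) [t³]¹⁰≈n³/64)))
      (-‿cong (*-cong (≈-refl {fromℚ (+ 1 ℚ./ 10)})
        (root-unique 4 {fromℚ (+ n ℚ./ 4)} (^-nonneg 2 0≤t)
          (≈-trans (solve 1 (λ t → (t ^ˢ 2) ^ˢ 5 := t ^ˢ 10) ≈-refl t) t¹⁰≈n/4)))))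
    (*-cong (≈-refl {fromℚ (+ 17 ℚ./ 20)}) (root-unique 9 {fromℚ (+ n ℚ./ 4)} 0≤t t¹⁰≈n/4))

-- `n₂` at 7/10 is about 97; `termwise` moves its evaluation to the rationals, where the comparison
-- is decided.
n₂≥105⇒≥7/10 : ∀ {s} → 0ℝ ≤ s → fromℕ 105 ≤ n₂ s → fromℚ (+ 7 ℚ./ 10) ≤ s
n₂≥105⇒≥7/10 {s} 0≤s 105≤n₂ = n₂-cancel-≤ 0≤s (≤-trans (≤-respˡ
  (≡⇒≈ {fromℚ (Polyℚ.n₂ (+ 7 ℚ./ 10))} {n₂ (fromℚ (+ 7 ℚ./ 10))}
    λ k → ≡.sym (Extends.termwise Extension.n₂-ext (fromℚ (+ 7 ℚ./ 10)) k))
  (fromℚ-mono-≤ (toWitness {a? = Polyℚ.n₂ (+ 7 ℚ./ 10) ℚ.≤? + 105 ℚ./ 1} _))) 105≤n₂)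

IsFloor-maximal : ∀ {x i m} → fromℤ i ≤ x → IsFloor x m → i ℤ.≤ m
IsFloor-maximal i≤x (_ , x<1+m) = ℤ.≮⇒≥ λ m<i →
  <⇒≱ (≤-<-trans i≤x x<1+m) (fromℚ-mono-≤ (/1-mono-≤ (ℤ.i<j⇒suc[i]≤j m<i)))

-- Solves the quadratic: s = √(x - 3/4) - 1/2, which is nonnegative because x - 3/4 ≥ 1/4.
p₂-surjective : ∀ {x} → 1ℝ ≤ x → ∃ λ s → 0ℝ ≤ s × x ≈ p₂ s
p₂-surjective {x} 1≤x = from-√ (0≤root 1 y) (root-^ 1 {y} 0≤y)
  where
  y : ℝ
  y = x - fromℚ (+ 3 ℚ./ 4)

  0≤y : 0ℝ ≤ y
  0≤y = 0≤y-x (≤-trans (fromℚ-mono-≤ (toWitness {a? = + 3 ℚ./ 4 ℚ.≤? 1ℚ} _)) 1≤x)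

  from-√ : ∀ {r} → 0ℝ ≤ r → r ^ 2 ≈ y → ∃ λ s → 0ℝ ≤ s × x ≈ p₂ s
  from-√ {r} 0≤r r²≈y = r - fromℚ ½
    , 0≤y-x (^-cancel-≤ 1 0≤r (≤-by (0≤y-x 1≤x)
        (≈-trans (solve 1 (λ x → con ½ ^ˢ 2 :+ (x :- con 1ℚ) := x :- con (+ 3 ℚ./ 4)) ≈-refl x) (≈-sym r²≈y))))
    , ≈-trans (solve 1 (λ x → x := x :- con (+ 3 ℚ./ 4) :+ con (+ 3 ℚ./ 4)) ≈-refl x)
      (≈-trans (+-cong (≈-sym r²≈y) ≈-refl)
        (solve 1 (λ r → r ^ˢ 2 :+ con (+ 3 ℚ./ 4) := p₂ˢ (r :- con ½)) ≈-refl r))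

-- Transfer of the integer shapes to real inequalities

module Bound {P₁ q₁ r₁ : ℕ} (0<P₁ : 0 ℕ.< P₁) where
  private
    X Q R : ℝ
    X = fromℕ P₁
    Q = fromℕ q₁
    R = fromℕ r₁

    0<X : 0ℝ < X
    0<X = fromℕ-mono-< 0<P₁

    fromℕ-suc : ∀ m → fromℕ (suc m) ≈ 1ℝ + fromℕ m
    fromℕ-suc m = fromℕ-+ 1 m

  module FromExtremal {E a c : ℕ} (P≡ : suc P₁ ≡ E ℕ.+ a) (E≡ : E ℕ.* suc c ≡ suc (a ℕ.* a))
    (q₁≡ : q₁ ≡ P₁ ℕ.* (suc P₁ ℕ.+ E)) (r₁≡ : r₁ ≡ P₁ ℕ.* (suc P₁ ℕ.+ (suc P₁ ℕ.+ suc (a ℕ.+ c)))) =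
    Extremal {X} {Q} {R} {fromℕ E} {fromℕ a} {fromℕ c} 0<X (fromℕ-nonneg E) (fromℕ-nonneg a) (fromℕ-nonneg c)
      (≈-trans (≈-sym (fromℕ-suc P₁)) (≈-trans (≡⇒≈ λ _ → cong (λ z → + z ℚ./ 1) P≡) (fromℕ-+ E a)))
      (≈-trans (≈-sym (≈-trans (fromℕ-* E (suc c)) (*-cong ≈-refl (fromℕ-suc c))))
        (≈-trans (≡⇒≈ λ _ → cong (λ z → + z ℚ./ 1) E≡)
          (≈-trans (fromℕ-suc (a ℕ.* a)) (+-cong ≈-refl (fromℕ-* a a)))))
      (≈-trans (≡⇒≈ λ _ → cong (λ z → + z ℚ./ 1) q₁≡) (≈-trans (fromℕ-* P₁ _)
        (*-cong ≈-refl (≈-trans (fromℕ-+ (suc P₁) E) (+-cong (fromℕ-suc P₁) ≈-refl)))))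
      (≈-trans (≡⇒≈ λ _ → cong (λ z → + z ℚ./ 1) r₁≡) (≈-trans (fromℕ-* P₁ _)
        (*-cong ≈-refl (≈-trans (fromℕ-+ (suc P₁) _) (+-cong (fromℕ-suc P₁)
          (≈-trans (fromℕ-+ (suc P₁) _) (+-cong (fromℕ-suc P₁)
            (≈-trans (fromℕ-suc (a ℕ.+ c)) (+-cong ≈-refl (fromℕ-+ a c))))))))))

  module FromDominated (2q₁≤ : 2 ℕ.* q₁ ℕ.≤ P₁ ℕ.* (suc P₁ ℕ.+ P₁))
    (≤Pr : suc P₁ ℕ.* suc q₁ ℕ.+ suc P₁ ℕ.+ q₁ ℕ.≤ suc P₁ ℕ.* suc r₁) =
    Dominated {X} {Q} {R} 0<X (fromℕ-nonneg q₁)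
      (≤-respˡ (fromℕ-* 2 q₁) (≤-respʳ
        (≈-trans (fromℕ-* P₁ _) (*-cong ≈-refl (≈-trans (fromℕ-+ (suc P₁) P₁) (+-cong (fromℕ-suc P₁) ≈-refl))))
        (fromℕ-mono-≤ 2q₁≤)))
      (≤-respˡ
        (≈-trans (fromℕ-+ (suc P₁ ℕ.* suc q₁ ℕ.+ suc P₁) q₁) (+-cong
          (≈-trans (fromℕ-+ (suc P₁ ℕ.* suc q₁) (suc P₁)) (+-cong
            (≈-trans (fromℕ-* (suc P₁) (suc q₁)) (*-cong (fromℕ-suc P₁) (fromℕ-suc q₁)))
            (fromℕ-suc P₁))) ≈-refl))
        (≤-respʳ (≈-trans (fromℕ-* (suc P₁) (suc r₁)) (*-cong (fromℕ-suc P₁) (fromℕ-suc r₁)))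
          (fromℕ-mono-≤ ≤Pr)))

  private
    n≈ : fromℕ (suc P₁ ℕ.* suc q₁ ℕ.* suc r₁) ≈ (1ℝ + X) * (1ℝ + Q) * (1ℝ + R)
    n≈ = ≈-trans (fromℕ-* (suc P₁ ℕ.* suc q₁) (suc r₁)) (*-cong
      (≈-trans (fromℕ-* (suc P₁) (suc q₁)) (*-cong (fromℕ-suc P₁) (fromℕ-suc q₁))) (fromℕ-suc r₁))

  module _ (sh : Shape P₁ q₁ r₁) {s : ℝ} (0≤s : 0ℝ ≤ s)
    (n₂s≈n : n₂ s ≈ fromℕ (suc P₁ ℕ.* suc q₁ ℕ.* suc r₁)) where

    private
      n≈n₂s : (1ℝ + X) * (1ℝ + Q) * (1ℝ + R) ≈ n₂ s
      n≈n₂s = ≈-sym (≈-trans n₂s≈n n≈)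

    q≤q₂ : fromℕ (suc q₁) ≤ q₂ s
    q≤q₂ = ≤-respˡ (≈-sym (fromℕ-suc q₁)) (≮⇒≥ λ q₂<q → <⇒≱ (n₂<n sh q₂<q) (≈⇒≤ n≈n₂s))
      where
      n₂<n : Shape P₁ q₁ r₁ → q₂ s < 1ℝ + Q → n₂ s < (1ℝ + X) * (1ℝ + Q) * (1ℝ + R)
      n₂<n (extremal E a c P≡ E≡ q₁≡ r₁≡) q₂<q = FromExtremal.q₂<q⇒n₂<n P≡ E≡ q₁≡ r₁≡ 0≤s q₂<q
      n₂<n (dominated 2q₁≤ ≤Pr) q₂<q = FromDominated.n₂<n 2q₁≤ ≤Pr 0≤s (<⇒≤ q₂<q)

    q≈q₂⇒q≈Q₂P : fromℕ (suc q₁) ≈ q₂ s → fromℕ (suc q₁) ≈ Q₂ (fromℕ (suc P₁))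
    q≈q₂⇒q≈Q₂P q≈q₂ = ≈-trans q≈q₂ (≈-sym (Q₂-p₂ 0≤s (≈-trans (fromℕ-suc P₁) (P≈p₂ sh))))
      where
      1+Q≈q₂ : 1ℝ + Q ≈ q₂ s
      1+Q≈q₂ = ≈-trans (≈-sym (fromℕ-suc q₁)) q≈q₂
      P≈p₂ : Shape P₁ q₁ r₁ → 1ℝ + X ≈ p₂ s
      P≈p₂ (extremal E a c P≡ E≡ q₁≡ r₁≡) = FromExtremal.q≈q₂⇒P≈p₂ P≡ E≡ q₁≡ r₁≡ 0≤s 1+Q≈q₂ n≈n₂s
      P≈p₂ (dominated 2q₁≤ ≤Pr) =
        contradiction (≈⇒≤ n≈n₂s) (<⇒≱ (FromDominated.n₂<n 2q₁≤ ≤Pr 0≤s (≈⇒≤ (≈-sym 1+Q≈q₂))))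

    -- The parameter u of P has no a priori relation to the parameter s of n. The shape yields n =
    -- `n₂ u`, hence s ≤ u, and q = `q₂ u` ≥ `q₂ s` meets the upper bound `q≤q₂`.
    q≈Q₂P⇒q≈q₂ : fromℕ (suc q₁) ≈ Q₂ (fromℕ (suc P₁)) → fromℕ (suc q₁) ≈ q₂ s
    q≈Q₂P⇒q≈q₂ q≈Q₂P = from-p₂ (p₂-surjective (fromℕ-mono-≤ {1} {suc P₁} (ℕ.s≤s ℕ.z≤n)))
      where
      from-p₂ : (∃ λ u → 0ℝ ≤ u × fromℕ (suc P₁) ≈ p₂ u) → fromℕ (suc q₁) ≈ q₂ s
      from-p₂ (u , 0≤u , P≈p₂u) = ≤-antisym q≤q₂ (≤-respʳ (≈-sym q≈q₂u)
        (q₂-mono-≤ 0≤s (n₂-cancel-≤ 0≤u (≈⇒≤ (≈-trans (≈-sym n≈n₂s) (n≈n₂u sh))))))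
        where
        q≈q₂u : fromℕ (suc q₁) ≈ q₂ u
        q≈q₂u = ≈-trans q≈Q₂P (Q₂-p₂ {fromℕ (suc P₁)} {u} 0≤u P≈p₂u)

        1+X≈ : 1ℝ + X ≈ p₂ u
        1+X≈ = ≈-trans (≈-sym (fromℕ-suc P₁)) P≈p₂u

        1+Q≈ : 1ℝ + Q ≈ q₂ u
        1+Q≈ = ≈-trans (≈-sym (fromℕ-suc q₁)) q≈q₂u

        n≈n₂u : Shape P₁ q₁ r₁ → (1ℝ + X) * (1ℝ + Q) * (1ℝ + R) ≈ n₂ u
        n≈n₂u (extremal E a c P≡ E≡ q₁≡ r₁≡) = FromExtremal.n≈n₂ P≡ E≡ q₁≡ r₁≡ 1+X≈ 1+Q≈
        n≈n₂u (dominated 2q₁≤ ≤Pr) = contradiction 1+Q≈ (FromDominated.q≉q₂ 2q₁≤ ≤Pr 0≤u 1+X≈)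

-- Bounds for a Korselt number in terms of its parameter

module _ {n : ℕ} (K : KorseltNumber n) where
  open KorseltNumber K

  105≤n : 105 ℕ.≤ n
  105≤n = ℕ.≤-trans (ℕ.*-mono-≤ (ℕ.*-mono-≤ (3≤P K) (5≤q K)) (7≤r K)) (ℕ.≤-reflexive (≡.sym (n≡Pqr K)))

  bounds : ∀ {s} → 0ℝ ≤ s → n₂ s ≈ fromℕ n →
    fromℕ q ≤ q₂ s × (fromℕ q ≈ q₂ s ⇔ fromℕ q ≈ Q₂ (fromℕ P))
  bounds {s} 0≤s n₂s≈n = go P q r (3≤P K) (5≤q K) (q<r K) (n≡Pqr K) (p-1∣n-1 _) (p-1∣n-1 _)
    where
    -- With P, q and r generalised to variables, matching on successors supplies P - 1, q - 1 and r
    -- - 1 without truncated subtraction.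
    go : ∀ P q r → 3 ℕ.≤ P → 5 ℕ.≤ q → q ℕ.< r → n ≡ P ℕ.* q ℕ.* r →
      (r ℕ.∸ 1) ∣ (n ℕ.∸ 1) → (q ℕ.∸ 1) ∣ (n ℕ.∸ 1) →
      fromℕ q ≤ q₂ s × (fromℕ q ≈ q₂ s ⇔ fromℕ q ≈ Q₂ (fromℕ P))
    go (suc P₁) (suc q₁) (suc r₁) (ℕ.s≤s 2≤P₁) (ℕ.s≤s 4≤q₁) (ℕ.s≤s q₁<r₁) ≡.refl r₁∣ q₁∣ =
      B.q≤q₂ sh 0≤s n₂s≈n , mk⇔ (B.q≈q₂⇒q≈Q₂P sh 0≤s n₂s≈n) (B.q≈Q₂P⇒q≈q₂ sh 0≤s n₂s≈n)
      where
      0<P₁ : 0 ℕ.< P₁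
      0<P₁ = ℕ.≤-trans (ℕ.s≤s ℕ.z≤n) 2≤P₁
      sh : Shape P₁ q₁ r₁
      sh = shape 0<P₁ (ℕ.≤-trans (ℕ.s≤s ℕ.z≤n) 4≤q₁) q₁<r₁ r₁∣ q₁∣
      module B = Bound {P₁} {q₁} {r₁} 0<P₁

theorem3p5 : ∀ {n : ℕ} (K : KorseltNumber n) →
  let open KorseltNumber K
      x = fromℕ n
      B = root 5 (fromℕ (2 ℕ.* n ℕ.^ 2))
            - root 10 (fromℚ (+ (n ℕ.^ 3) ℚ./ 64))
            - fromℚ (+ 1 ℚ./ 10) * root 5 (fromℚ (+ n ℚ./ 4))
            + fromℚ (+ 17 ℚ./ 20) * root 10 (fromℚ (+ n ℚ./ 4))
  in fromℕ q ≤ Q₂ (N₂⁻¹ x)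
   × Q₂ (N₂⁻¹ x) ≈ q₂ (n₂⁻¹ x)
   × (fromℕ q ≈ Q₂ (N₂⁻¹ x) ⇔ fromℕ q ≈ Q₂ (fromℕ P))
   × fromℕ q ≤ B
   × (∀ (m : ℤ) → IsFloor B m → + q ℤ.≤ m)
theorem3p5 {n} K =
    ≤-respʳ (≈-sym Q₂≈q₂) (proj₁ q-bounds)
  , Q₂≈q₂
  , mk⇔ (λ q≈Q₂ → Equivalence.to (proj₂ q-bounds) (≈-trans q≈Q₂ Q₂≈q₂))
        (λ q≈Q₂P → ≈-trans (Equivalence.from (proj₂ q-bounds) q≈Q₂P) (≈-sym Q₂≈q₂))
  , q≤B
  , λ m → IsFloor-maximal q≤B
  where
  open KorseltNumber K using (q; P)
  σ t B : ℝ
  σ = n₂⁻¹ (fromℕ n)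
  t = root 10 (fromℚ (+ n ℚ./ 4))
  B = root 5 (fromℕ (2 ℕ.* n ℕ.^ 2))
        - root 10 (fromℚ (+ (n ℕ.^ 3) ℚ./ 64))
        - fromℚ (+ 1 ℚ./ 10) * root 5 (fromℚ (+ n ℚ./ 4))
        + fromℚ (+ 17 ℚ./ 20) * root 10 (fromℚ (+ n ℚ./ 4))

  1≤n : 1ℝ ≤ fromℕ n
  1≤n = fromℕ-mono-≤ {1} (ℕ.≤-trans (ℕ.s≤s ℕ.z≤n) (105≤n K))

  0≤σ : 0ℝ ≤ σ
  0≤σ = 0≤n₂⁻¹ (fromℕ n)

  n₂σ≈n : n₂ σ ≈ fromℕ n
  n₂σ≈n = n₂-n₂⁻¹ {fromℕ n} 1≤n

  Q₂≈q₂ : Q₂ (N₂⁻¹ (fromℕ n)) ≈ q₂ σ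
  Q₂≈q₂ = Q₂-p₂ {N₂⁻¹ (fromℕ n)} {σ} 0≤σ (N₂⁻¹≈p₂-n₂⁻¹ {fromℕ n} 1≤n)

  q-bounds : fromℕ q ≤ q₂ σ × (fromℕ q ≈ q₂ σ ⇔ fromℕ q ≈ Q₂ (fromℕ P))
  q-bounds = bounds K {σ} 0≤σ n₂σ≈n

  q≤B : fromℕ q ≤ B
  q≤B = q≤root-expression {σ} {t} 0≤σ n₂σ≈n (0≤root 9 (fromℚ (+ n ℚ./ 4)))
    (root-^ 9 {fromℚ (+ n ℚ./ 4)} (fromℚ-mono-≤ (0≤/suc n 3)))
    where
    q≤root-expression : ∀ {s t} → 0ℝ ≤ s → n₂ s ≈ fromℕ n → 0ℝ ≤ t → t ^ 10 ≈ fromℚ (+ n ℚ./ 4) → fromℕ q ≤ B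
    q≤root-expression {s} {t} 0≤s n₂≈n 0≤t t¹⁰≈n/4 =
      ≤-trans (proj₁ (bounds K {s} 0≤s n₂≈n)) (≤-respʳ (≈-sym root-expression)
        (q₂≤tenth-root-polynomial
          (n₂≥105⇒≥7/10 0≤s (≤-respʳ (≈-sym n₂≈n) (fromℕ-mono-≤ (105≤n K)))) 0≤t (≈-trans n₂≈n n≈4t¹⁰)))
      where open RootExpression {n} {t} 0≤t t¹⁰≈n/4
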